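{- For all one-free expressions $e,f$ over $X$, $e\equiv f$ if and only if $e\simeq f$.
   Context: Fix a set $X$ of variables. One-free expressions are generated by $e,f::= x \mid 0\mid e+f\mid e\cdot f\mid e\cap f\mid e^+\mid \overline{e}$ ($x\in X$). Semantics: for an alphabet $\Sigma$ and $\sigma:X\to\mathcal P(\Sigma^\star)$, $[\![x]\!]_\sigma=\sigma(x)$, $[\![0]\!]_\sigma=\emptyset$, $+$ union, $\cap$ intersection, $\cdot$ concatenation, $e^+$ is $\bigcup_{n\ge1}[\![e]\!]_\sigma^n$, $\overline e$ the set of reversed words of $[\![e]\!]_\sigma$; $e\simeq f$ iff $[\![e]\!]_\sigma=[\![f]\!]_\sigma$ for all $\Sigma,\sigma$. Here $\equiv$ is the smallest congruence on one-free expressions containing, for all $e,f,g$: $e+f=f+e$; $e+(f+g)=(e+f)+g$; $e+0=e$; $e\cap f=f\cap e$; $e\cap e=e$; $e\cap(f\cap g)=(e\cap f)\cap g$; $(e+f)\cap g=e\cap g+f\cap g$; $(e\cap f)+e=e$; $e\cdot(f\cdot g)=(e\cdot f)\cdot g$; $e\cdot 0=0=0\cdot e$; $(e+f)\cdot g=e\cdot g+f\cdot g$; $e\cdot(f+g)=e\cdot f+e\cdot g$; $e^+=e+e\cdot e^+$; $e^+=e+e^+\cdot e$; $\overline{\overline e}=e$; $\overline{e+f}=\overline e+\overline f$; $\overline{e\cdot f}=\overline f\cdot\overline e$; $\overline{e\cap f}=\overline e\cap\overline f$; $\overline{e^+}=\overline e^{\,+}$; and closed under the rules: if $e\cdot f+f\equiv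 f$ then $e^+\cdot f+f\equiv f$; if $f\cdot e+f\equiv f$ then $f\cdot e^++f\equiv f$. -}

module Defs where

open import Data.Nat using (ℕ; zero; suc)
open import Data.List using (List; _++_; reverse)
open import Data.Product using (Σ; ∃; ∃-syntax; _×_)
open import Relation.Binary.PropositionalEquality using (_≡_)
open import Function.Bundles using (_⇔_)

data Expr (X : Set) : Set where
  var  : X → Expr X
  𝟘    : Expr X
  _⊕_  : Expr X → Expr X → Expr X
  _⊙_  : Expr X → Expr X → Expr X
  _⊓_  : Expr X → Expr X → Expr X
  _⁺   : Expr X → Expr X
  conv : Expr X → Expr X

infixl 6 _⊕_
infixl 7 _⊓_
infixl 8 _⊙_
infix 9 _⁺

Lang : Set → Set₁
Lang A = List A → Set

module _ {A : Set} where

  ∅L : Lang A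
  ∅L _ = Data.Empty.⊥
    where import Data.Empty

  _∪L_ : Lang A → Lang A → Lang A
  (L ∪L M) w = Data.Sum._⊎_ (L w) (M w)
    where import Data.Sum

  _∩L_ : Lang A → Lang A → Lang A
  (L ∩L M) w = L w × M w

  _·L_ : Lang A → Lang A → Lang A
  (L ·L M) w = ∃[ u ] ∃[ v ] (w ≡ u ++ v × L u × M v)

  -- L ^ (suc n) : the (n+1)-fold concatenation power
  pow1 : Lang A → ℕ → Lang A
  pow1 L zero    = L
  pow1 L (suc n) = L ·L pow1 L n

  plusL : Lang A → Lang A
  plusL L w = ∃[ n ] pow1 L n w

  revL : Lang A → Lang A
  revL L w = ∃[ u ] (L u × w ≡ reverse u)

⟦_⟧ : {X A : Set} → Expr X → (X → Lang A) → Lang A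
⟦ var x ⟧ σ    = σ x
⟦ 𝟘 ⟧ σ        = ∅L
⟦ e ⊕ f ⟧ σ    = ⟦ e ⟧ σ ∪L ⟦ f ⟧ σ
⟦ e ⊙ f ⟧ σ    = ⟦ e ⟧ σ ·L ⟦ f ⟧ σ
⟦ e ⊓ f ⟧ σ    = ⟦ e ⟧ σ ∩L ⟦ f ⟧ σ
⟦ e ⁺ ⟧ σ      = plusL (⟦ e ⟧ σ)
⟦ conv e ⟧ σ   = revL (⟦ e ⟧ σ)

_≃_ : {X : Set} → Expr X → Expr X → Set₁
e ≃ f = ∀ (A : Set) (σ : _ → Lang A) (w : List A) → ⟦ e ⟧ σ w ⇔ ⟦ f ⟧ σ w

infix 4 _≃_ _≣_

data _≣_ {X : Set} : Expr X → Expr X → Set where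
  ≣-refl  : ∀ {e} → e ≣ e
  ≣-sym   : ∀ {e f} → e ≣ f → f ≣ e
  ≣-trans : ∀ {e f g} → e ≣ f → f ≣ g → e ≣ g
  ⊕-cong  : ∀ {e e′ f f′} → e ≣ e′ → f ≣ f′ → e ⊕ f ≣ e′ ⊕ f′
  ⊙-cong  : ∀ {e e′ f f′} → e ≣ e′ → f ≣ f′ → e ⊙ f ≣ e′ ⊙ f′
  ⊓-cong  : ∀ {e e′ f f′} → e ≣ e′ → f ≣ f′ → e ⊓ f ≣ e′ ⊓ f′
  ⁺-cong  : ∀ {e e′} → e ≣ e′ → e ⁺ ≣ e′ ⁺
  conv-cong : ∀ {e e′} → e ≣ e′ → conv e ≣ conv e′
  ⊕-comm   : ∀ e f → e ⊕ f ≣ f ⊕ e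
  ⊕-assoc  : ∀ e f g → e ⊕ (f ⊕ g) ≣ (e ⊕ f) ⊕ g
  ⊕-zero   : ∀ e → e ⊕ 𝟘 ≣ e
  ⊓-comm   : ∀ e f → e ⊓ f ≣ f ⊓ e
  ⊓-idem   : ∀ e → e ⊓ e ≣ e
  ⊓-assoc  : ∀ e f g → e ⊓ (f ⊓ g) ≣ (e ⊓ f) ⊓ g
  ⊓-distr  : ∀ e f g → (e ⊕ f) ⊓ g ≣ e ⊓ g ⊕ f ⊓ g
  absorb   : ∀ e f → (e ⊓ f) ⊕ e ≣ e
  ⊙-assoc  : ∀ e f g → e ⊙ (f ⊙ g) ≣ (e ⊙ f) ⊙ g
  ⊙-zeroʳ  : ∀ e → e ⊙ 𝟘 ≣ 𝟘
  ⊙-zeroˡ  : ∀ e → 𝟘 ⊙ e ≣ 𝟘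
  ⊙-distrʳ : ∀ e f g → (e ⊕ f) ⊙ g ≣ e ⊙ g ⊕ f ⊙ g
  ⊙-distrˡ : ∀ e f g → e ⊙ (f ⊕ g) ≣ e ⊙ f ⊕ e ⊙ g
  ⁺-unfoldˡ : ∀ e → e ⁺ ≣ e ⊕ e ⊙ e ⁺
  ⁺-unfoldʳ : ∀ e → e ⁺ ≣ e ⊕ e ⁺ ⊙ e
  conv-inv  : ∀ e → conv (conv e) ≣ e
  conv-⊕    : ∀ e f → conv (e ⊕ f) ≣ conv e ⊕ conv f
  conv-⊙    : ∀ e f → conv (e ⊙ f) ≣ conv f ⊙ conv e
  conv-⊓    : ∀ e f → conv (e ⊓ f) ≣ conv e ⊓ conv f
  conv-⁺    : ∀ e → conv (e ⁺) ≣ (conv e) ⁺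
  ⁺-indˡ : ∀ {e f} → e ⊙ f ⊕ f ≣ f → e ⁺ ⊙ f ⊕ f ≣ f
  ⁺-indʳ : ∀ {e f} → f ⊙ e ⊕ f ≣ f → f ⊙ e ⁺ ⊕ f ≣ f

{-# OPTIONS --safe #-}
module Submission where

-- Completeness.  Mirror images are pushed down to the variables.  A one-free expression e then
-- denotes a set of series-parallel terms (variables composed by · and ∩), and drawing such a term
-- on the line of natural numbers gives a language model that contains exactly the edges of the
-- term.  A path in this model representing an expression f can be cut at a vertex of a series
-- composition, and it stays in one branch of a parallel composition.  Both operations only produce
-- segments of f, of which there are finitely many, so the segments above a composite term are
-- provably determined by those above its components.  Hence e is provably below the finite join,
-- over the terms t of e, of the meets of all segments of f above t: for e⁺ this follows from the
-- induction rule.  If e is semantically below f, each of these meets has f itself as a factor.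

open import Defs
open import Function.Bundles using (_⇔_; mk⇔; Equivalence)
open import Function.Base using (_∘_; id)
open import Data.Bool.Base using (Bool; true; false; not)
open import Data.Empty using (⊥; ⊥-elim)
open import Data.List.Base using (List; []; _∷_; _++_; reverse; map; cartesianProductWith)
open import Data.List.Properties using (++-assoc; reverse-++; reverse-involutive; reverse-injective; ∷-injectiveˡ; ∷-injectiveʳ)
open import Data.List.Membership.Propositional using (_∈_)
open import Data.List.Membership.Propositional.Properties using (∈-map⁺; ∈-++⁺ˡ; ∈-++⁺ʳ; ∈-cartesianProductWith⁺)
open import Data.List.Relation.Unary.All as All using (All; []; _∷_)
open import Data.List.Relation.Unary.All.Properties using (++⁺)
open import Data.List.Relation.Unary.Any using (here; there)
open import Data.Maybe.Base as Maybe using (Maybe; just; nothing)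
open import Data.Nat.Base using (ℕ; zero; suc; _+_; _∸_; _≤_; _<_; z≤n; s≤s)
open import Data.Nat.Properties using (≤-refl; ≤-trans; ≤-antisym; <-irrefl; <-trans; <-≤-trans; ≤-<-trans; <⇒≤; ≮⇒≥; <-cmp; _<?_; m≤m+n; m<m+n; m≤n⇒m<n∨m≡n; +-assoc; +-comm; +-suc; +-identityʳ; +-monoʳ-≤; +-monoʳ-<; m+n∸m≡n; m+[n∸m]≡n; ∸-+-assoc; +-∸-assoc; m<n⇒0<n∸m; m∸n≢0⇒n<m)
open import Data.Product using (∃; ∃₂; _×_; _,_; proj₁; proj₂)
open import Data.Sum.Base as Sum using (_⊎_; inj₁; inj₂; [_,_]′)
open import Data.Unit.Base using (⊤; tt)
open import Relation.Binary.Construct.Closure.ReflexiveTransitive using (Star; ε; _◅_; _◅◅_)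
open import Relation.Binary.Definitions using (tri<; tri≈; tri>)
open import Relation.Binary.PropositionalEquality using (_≡_; refl; sym; trans; cong; cong₂; subst; subst₂)
open import Relation.Nullary.Decidable.Core using (yes; no)

private
  variable
    X A : Set

-- Soundness

module _ {A : Set} where

  ·L-mono : {L L′ M M′ : Lang A} → (∀ w → L w → L′ w) → (∀ w → M w → M′ w) →
            ∀ w → (L ·L M) w → (L′ ·L M′) w
  ·L-mono f g w (u , v , eq , Lu , Mv) = u , v , eq , f u Lu , g v Mv

  ·L-assocˡ : {L M N : Lang A} → ∀ w → (L ·L (M ·L N)) w → ((L ·L M) ·L N) w
  ·L-assocˡ _ (u , _ , refl , Lu , (v , w , refl , Mv , Nw)) =
    u ++ v , w , sym (++-assoc u v w) , (u , v , refl , Lu , Mv) , Nw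

  ·L-assocʳ : {L M N : Lang A} → ∀ w → ((L ·L M) ·L N) w → (L ·L (M ·L N)) w
  ·L-assocʳ _ (_ , w , refl , (u , v , refl , Lu , Mv) , Nw) =
    u , v ++ w , ++-assoc u v w , Lu , (v , w , refl , Mv , Nw)

  pow1-mono : {L M : Lang A} → (∀ w → L w → M w) → ∀ n w → pow1 L n w → pow1 M n w
  pow1-mono f zero    = f
  pow1-mono f (suc n) = ·L-mono f (pow1-mono f n)

  -- `pow1` adds factors on the left. The right unfolding axiom and reversal, which turns a first
  -- factor into a last one, need them added on the right.
  pow1-snoc : {L : Lang A} → ∀ n w → (pow1 L n ·L L) w → pow1 L (suc n) w
  pow1-snoc zero    w x = x
  pow1-snoc (suc n) w x = ·L-mono (λ _ → id) (pow1-snoc n) w (·L-assocʳ w x)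

  pow1-unsnoc : {L : Lang A} → ∀ n w → pow1 L (suc n) w → (pow1 L n ·L L) w
  pow1-unsnoc zero    w x = x
  pow1-unsnoc (suc n) w x = ·L-assocˡ w (·L-mono (λ _ → id) (pow1-unsnoc n) w x)

  plusL-snoc : {L : Lang A} → ∀ w → (plusL L ·L L) w → plusL L w
  plusL-snoc w (u , v , eq , (n , Lu) , Lv) = suc n , pow1-snoc n w (u , v , eq , Lu , Lv)

  revL-·ˡ : {L M : Lang A} → ∀ w → revL (L ·L M) w → (revL M ·L revL L) w
  revL-·ˡ _ (_ , (u , v , refl , Lu , Mv) , refl) =
    reverse v , reverse u , reverse-++ u v , (v , Mv , refl) , (u , Lu , refl)

  revL-·ʳ : {L M : Lang A} → ∀ w → (revL M ·L revL L) w → revL (L ·L M) w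
  revL-·ʳ _ (_ , _ , refl , (v , Mv , refl) , (u , Lu , refl)) =
    u ++ v , (u , v , refl , Lu , Mv) , sym (reverse-++ u v)

  revL-pow1ˡ : {L : Lang A} → ∀ n w → revL (pow1 L n) w → pow1 (revL L) n w
  revL-pow1ˡ zero    w x = x
  revL-pow1ˡ (suc n) w x =
    pow1-snoc n w (·L-mono (revL-pow1ˡ n) (λ _ → id) w (revL-·ˡ w x))

  revL-pow1ʳ : {L : Lang A} → ∀ n w → pow1 (revL L) n w → revL (pow1 L n) w
  revL-pow1ʳ zero    w x = x
  revL-pow1ʳ (suc n) w x =
    revL-·ʳ w (·L-mono (revL-pow1ʳ n) (λ _ → id) w (pow1-unsnoc n w x))

  pow1-absorbˡ : {L M : Lang A} → (∀ w → (L ·L M) w → M w) → ∀ n w → (pow1 L n ·L M) w → M w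
  pow1-absorbˡ f zero    w x = f w x
  pow1-absorbˡ f (suc n) w x = f w (·L-mono (λ _ → id) (pow1-absorbˡ f n) w (·L-assocʳ w x))

  pow1-absorbʳ : {L M : Lang A} → (∀ w → (M ·L L) w → M w) → ∀ n w → (M ·L pow1 L n) w → M w
  pow1-absorbʳ f zero    w x = f w x
  pow1-absorbʳ f (suc n) w x = pow1-absorbʳ f n w (·L-mono f (λ _ → id) w (·L-assocˡ w x))

  -- Both inclusions are carried through one induction on the derivation, because `≣-sym` exchanges
  -- them.
  ⟦⟧-sound : {σ : X → Lang A} {e f : Expr X} → e ≣ f →
             ∀ w → (⟦ e ⟧ σ w → ⟦ f ⟧ σ w) × (⟦ f ⟧ σ w → ⟦ e ⟧ σ w)
  ⟦⟧-sound ≣-refl w = id , id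
  ⟦⟧-sound (≣-sym p) w = proj₂ (⟦⟧-sound p w) , proj₁ (⟦⟧-sound p w)
  ⟦⟧-sound (≣-trans p q) w =
    proj₁ (⟦⟧-sound q w) ∘ proj₁ (⟦⟧-sound p w) , proj₂ (⟦⟧-sound p w) ∘ proj₂ (⟦⟧-sound q w)
  ⟦⟧-sound (⊕-cong p q) w =
    Sum.map (proj₁ (⟦⟧-sound p w)) (proj₁ (⟦⟧-sound q w)) ,
    Sum.map (proj₂ (⟦⟧-sound p w)) (proj₂ (⟦⟧-sound q w))
  ⟦⟧-sound (⊙-cong p q) w =
    ·L-mono (λ u → proj₁ (⟦⟧-sound p u)) (λ u → proj₁ (⟦⟧-sound q u)) w ,
    ·L-mono (λ u → proj₂ (⟦⟧-sound p u)) (λ u → proj₂ (⟦⟧-sound q u)) w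
  ⟦⟧-sound (⊓-cong p q) w =
    (λ (x , y) → proj₁ (⟦⟧-sound p w) x , proj₁ (⟦⟧-sound q w) y) ,
    (λ (x , y) → proj₂ (⟦⟧-sound p w) x , proj₂ (⟦⟧-sound q w) y)
  ⟦⟧-sound (⁺-cong p) w =
    (λ (n , x) → n , pow1-mono (λ u → proj₁ (⟦⟧-sound p u)) n w x) ,
    (λ (n , x) → n , pow1-mono (λ u → proj₂ (⟦⟧-sound p u)) n w x)
  ⟦⟧-sound (conv-cong p) w =
    (λ (u , x , eq) → u , proj₁ (⟦⟧-sound p u) x , eq) ,
    (λ (u , x , eq) → u , proj₂ (⟦⟧-sound p u) x , eq)
  ⟦⟧-sound (⊕-comm e f) w = Sum.swap , Sum.swap
  ⟦⟧-sound (⊕-assoc e f g) w = Sum.assocˡ , Sum.assocʳ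
  ⟦⟧-sound (⊕-zero e) w = (λ { (inj₁ x) → x }) , inj₁
  ⟦⟧-sound (⊓-comm e f) w = (λ (x , y) → y , x) , (λ (x , y) → y , x)
  ⟦⟧-sound (⊓-idem e) w = proj₁ , (λ x → x , x)
  ⟦⟧-sound (⊓-assoc e f g) w = (λ (x , y , z) → (x , y) , z) , (λ ((x , y) , z) → x , y , z)
  ⟦⟧-sound (⊓-distr e f g) w =
    (λ { (inj₁ x , z) → inj₁ (x , z) ; (inj₂ y , z) → inj₂ (y , z) }) ,
    (λ { (inj₁ (x , z)) → inj₁ x , z ; (inj₂ (y , z)) → inj₂ y , z })
  ⟦⟧-sound (absorb e f) w = [ proj₁ , id ]′ , inj₂
  ⟦⟧-sound (⊙-assoc e f g) w = ·L-assocˡ w , ·L-assocʳ w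
  ⟦⟧-sound (⊙-zeroʳ e) w = (λ ()) , (λ ())
  ⟦⟧-sound (⊙-zeroˡ e) w = (λ ()) , (λ ())
  ⟦⟧-sound (⊙-distrʳ e f g) w =
    (λ { (u , v , eq , inj₁ x , z) → inj₁ (u , v , eq , x , z)
       ; (u , v , eq , inj₂ y , z) → inj₂ (u , v , eq , y , z) }) ,
    [ ·L-mono (λ _ → inj₁) (λ _ → id) w , ·L-mono (λ _ → inj₂) (λ _ → id) w ]′
  ⟦⟧-sound (⊙-distrˡ e f g) w =
    (λ { (u , v , eq , x , inj₁ y) → inj₁ (u , v , eq , x , y)
       ; (u , v , eq , x , inj₂ z) → inj₂ (u , v , eq , x , z) }) ,
    [ ·L-mono (λ _ → id) (λ _ → inj₁) w , ·L-mono (λ _ → id) (λ _ → inj₂) w ]′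
  ⟦⟧-sound (⁺-unfoldˡ e) w =
    (λ { (zero , x) → inj₁ x
       ; (suc n , u , v , eq , x , y) → inj₂ (u , v , eq , x , n , y) }) ,
    (λ { (inj₁ x) → zero , x
       ; (inj₂ (u , v , eq , x , n , y)) → suc n , u , v , eq , x , y })
  ⟦⟧-sound (⁺-unfoldʳ e) w =
    (λ { (zero , x) → inj₁ x
       ; (suc n , x) → inj₂ (·L-mono (λ _ → n ,_) (λ _ → id) w (pow1-unsnoc n w x)) }) ,
    [ zero ,_ , plusL-snoc w ]′
  ⟦⟧-sound (conv-inv e) w =
    (λ { (_ , (u , x , refl) , refl) → subst (⟦ e ⟧ _) (sym (reverse-involutive u)) x }) ,
    (λ x → reverse w , (w , x , refl) , sym (reverse-involutive w))
  ⟦⟧-sound (conv-⊕ e f) w =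
    (λ { (u , inj₁ x , eq) → inj₁ (u , x , eq) ; (u , inj₂ y , eq) → inj₂ (u , y , eq) }) ,
    (λ { (inj₁ (u , x , eq)) → u , inj₁ x , eq ; (inj₂ (u , y , eq)) → u , inj₂ y , eq })
  ⟦⟧-sound (conv-⊙ e f) w = revL-·ˡ w , revL-·ʳ w
  ⟦⟧-sound (conv-⊓ e f) w =
    (λ (u , (x , y) , eq) → (u , x , eq) , (u , y , eq)) ,
    -- Injectivity of reversal identifies the two preimages `u` and `v`.
    (λ { ((u , x , refl) , (v , y , eq)) → u , (x , subst (⟦ f ⟧ _) (sym (reverse-injective eq)) y) , refl })
  ⟦⟧-sound (conv-⁺ e) w =
    (λ (u , (n , x) , eq) → n , revL-pow1ˡ n w (u , x , eq)) ,
    (λ (n , x) → let (u , y , eq) = revL-pow1ʳ n w x in u , (n , y) , eq)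
  ⟦⟧-sound (⁺-indˡ p) w =
    (λ { (inj₁ (u , v , eq , (n , x) , y)) →
           pow1-absorbˡ (λ u z → proj₁ (⟦⟧-sound p u) (inj₁ z)) n w (u , v , eq , x , y)
       ; (inj₂ y) → y }) , inj₂
  ⟦⟧-sound (⁺-indʳ p) w =
    (λ { (inj₁ (u , v , eq , y , (n , x))) →
           pow1-absorbʳ (λ u z → proj₁ (⟦⟧-sound p u) (inj₁ z)) n w (u , v , eq , y , x)
       ; (inj₂ y) → y }) , inj₂

-- The order induced by union

infix 4 _≲_
_≲_ : Expr X → Expr X → Set
a ≲ b = a ⊕ b ≣ b

module _ {X : Set} where

  private
    variable
      a b c d z : Expr X

  -- Idempotence of `⊕` is not among the axioms; it comes from `⊓-idem` and absorption.
  ≲-refl : a ≲ a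
  ≲-refl {a} = ≣-trans (⊕-cong (≣-sym (⊓-idem a)) ≣-refl) (absorb a a)

  ≲-reflexive : a ≣ b → a ≲ b
  ≲-reflexive p = ≣-trans (⊕-cong p ≣-refl) ≲-refl

  ≲-trans : a ≲ b → b ≲ c → a ≲ c
  ≲-trans {a} {b} {c} p q =
    ≣-trans (⊕-cong ≣-refl (≣-sym q))
      (≣-trans (⊕-assoc a b c) (≣-trans (⊕-cong p ≣-refl) q))

  ≲-antisym : a ≲ b → b ≲ a → a ≣ b
  ≲-antisym {a} {b} p q = ≣-trans (≣-sym q) (≣-trans (⊕-comm b a) p)

  𝟘-least : 𝟘 ≲ a
  𝟘-least {a} = ≣-trans (⊕-comm 𝟘 a) (⊕-zero a)

  ⊕-upperˡ : a ≲ a ⊕ b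
  ⊕-upperˡ {a} {b} = ≣-trans (⊕-assoc a a b) (⊕-cong ≲-refl ≣-refl)

  ⊕-upperʳ : b ≲ a ⊕ b
  ⊕-upperʳ {b} {a} = ≲-trans ⊕-upperˡ (≲-reflexive (⊕-comm b a))

  ⊕-lub : a ≲ c → b ≲ c → a ⊕ b ≲ c
  ⊕-lub {a} {c} {b} p q = ≣-trans (≣-sym (⊕-assoc a b c)) (≣-trans (⊕-cong ≣-refl q) p)

  ⊕-mono : a ≲ b → c ≲ d → a ⊕ c ≲ b ⊕ d
  ⊕-mono p q = ⊕-lub (≲-trans p ⊕-upperˡ) (≲-trans q ⊕-upperʳ)

  ⊓-lowerˡ : a ⊓ b ≲ a
  ⊓-lowerˡ {a} {b} = absorb a b

  ⊓-lowerʳ : a ⊓ b ≲ b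
  ⊓-lowerʳ {a} {b} = ≲-trans (≲-reflexive (⊓-comm a b)) ⊓-lowerˡ

  -- Distributivity expands `(a ⊕ b) ⊓ a` to `a ⊕ b ⊓ a`, which absorption collapses to `a`;
  -- rewriting `a ⊕ b` to `b` leaves the meet.
  ≲⇒⊓ : a ≲ b → a ≣ a ⊓ b
  ≲⇒⊓ {a} {b} p =
    ≣-trans
      (≣-sym (≣-trans (⊓-distr a b a)
        (≣-trans (⊕-cong (⊓-idem a) ≣-refl)
          (≣-trans (⊕-comm a (b ⊓ a)) (≣-trans (⊕-cong (⊓-comm b a) ≣-refl) (absorb a b))))))
      (≣-trans (⊓-cong p ≣-refl) (⊓-comm b a))

  ⊓-glb : c ≲ a → c ≲ b → c ≲ a ⊓ b
  ⊓-glb {c} {a} {b} p q =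
    ≲-trans
      (≲-reflexive (≣-trans (≲⇒⊓ q) (≣-trans (⊓-cong (≲⇒⊓ p) ≣-refl) (≣-sym (⊓-assoc c a b)))))
      ⊓-lowerʳ

  ⊓-mono : a ≲ b → c ≲ d → a ⊓ c ≲ b ⊓ d
  ⊓-mono p q = ⊓-glb (≲-trans ⊓-lowerˡ p) (≲-trans ⊓-lowerʳ q)

  ⊙-monoˡ : a ≲ b → a ⊙ c ≲ b ⊙ c
  ⊙-monoˡ {a} {b} {c} p = ≣-trans (≣-sym (⊙-distrʳ a b c)) (⊙-cong p ≣-refl)

  ⊙-monoʳ : a ≲ b → c ⊙ a ≲ c ⊙ b
  ⊙-monoʳ {a} {b} {c} p = ≣-trans (≣-sym (⊙-distrˡ c a b)) (⊙-cong ≣-refl p)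

  ⊙-mono : a ≲ b → c ≲ d → a ⊙ c ≲ b ⊙ d
  ⊙-mono p q = ≲-trans (⊙-monoˡ p) (⊙-monoʳ q)

  ⊙-assocˡ : a ⊙ (b ⊙ c) ≲ a ⊙ b ⊙ c
  ⊙-assocˡ {a} {b} {c} = ≲-reflexive (⊙-assoc a b c)

  ⊙-assocʳ : a ⊙ b ⊙ c ≲ a ⊙ (b ⊙ c)
  ⊙-assocʳ {a} {b} {c} = ≲-reflexive (≣-sym (⊙-assoc a b c))

  ⁺-base : a ≲ a ⁺
  ⁺-base {a} = ≲-trans ⊕-upperˡ (≲-reflexive (≣-sym (⁺-unfoldˡ a)))

  ⁺-cons : a ⊙ a ⁺ ≲ a ⁺
  ⁺-cons {a} = ≲-trans ⊕-upperʳ (≲-reflexive (≣-sym (⁺-unfoldˡ a)))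

  ⁺-trans : a ⁺ ⊙ a ⁺ ≲ a ⁺
  ⁺-trans = ⁺-indˡ ⁺-cons

  -- Unfolding on the right leaves a last factor `a`, which is enlarged to `z`; then `⁺-indˡ`
  -- absorbs the iteration in front of it.
  ⁺-least : a ≲ z → a ⊙ z ≲ z → a ⁺ ≲ z
  ⁺-least {a} p q =
    ≲-trans (≲-reflexive (⁺-unfoldʳ a)) (⊕-lub p (≲-trans (⊙-monoʳ p) (⁺-indˡ q)))

  -- Adding `𝟘`, written as `conv (conv 𝟘)`, to `conv 𝟘` gives `conv (𝟘 ⊕ conv 𝟘)`, which is
  -- `conv (conv 𝟘)` again.
  conv-𝟘 : conv 𝟘 ≣ 𝟘 {X}
  conv-𝟘 =
    ≣-trans (≣-sym (⊕-zero (conv 𝟘)))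
      (≣-trans (⊕-cong ≣-refl (≣-sym (conv-inv 𝟘)))
        (≣-trans (≣-sym (conv-⊕ 𝟘 (conv 𝟘))) (≣-trans (conv-cong 𝟘-least) (conv-inv 𝟘))))

-- Mirror-free expressions

Literal : Set → Set
Literal X = X × Bool

-- Naming the three binary operations lets `Segment` and `core` treat them uniformly.
data Op : Set where
  union concat inter : Op

data Core (X : Set) : Set where
  lit : Literal X → Core X
  ∅   : Core X
  bin : Op → Core X → Core X → Core X
  _₊  : Core X → Core X

infixl 6 _∪_
infixl 7 _∩_
infixl 8 _∙_
infix 9 _₊

pattern _∪_ f g = bin union f g
pattern _∙_ f g = bin concat f g
pattern _∩_ f g = bin inter f g

literal : Literal X → Expr X
literal (x , false) = var x
literal (x , true)  = conv (var x)

⌜_⌝ : Core X → Expr X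
⌜ lit y ⌝ = literal y
⌜ ∅ ⌝     = 𝟘
⌜ f ∪ g ⌝ = ⌜ f ⌝ ⊕ ⌜ g ⌝
⌜ f ∙ g ⌝ = ⌜ f ⌝ ⊙ ⌜ g ⌝
⌜ f ∩ g ⌝ = ⌜ f ⌝ ⊓ ⌜ g ⌝
⌜ f ₊ ⌝   = ⌜ f ⌝ ⁺

pushMirror : Bool → Expr X → Core X
pushMirror b     (var x)  = lit (x , b)
pushMirror b     𝟘        = ∅
pushMirror b     (e ⊕ f)  = pushMirror b e ∪ pushMirror b f
pushMirror false (e ⊙ f)  = pushMirror false e ∙ pushMirror false f
pushMirror true  (e ⊙ f)  = pushMirror true f ∙ pushMirror true e
pushMirror b     (e ⊓ f)  = pushMirror b e ∩ pushMirror b f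
pushMirror b     (e ⁺)    = pushMirror b e ₊
pushMirror b     (conv e) = pushMirror (not b) e

mirrorIf : Bool → Expr X → Expr X
mirrorIf false e = e
mirrorIf true  e = conv e

pushMirror-≣ : ∀ b (e : Expr X) → ⌜ pushMirror b e ⌝ ≣ mirrorIf b e
pushMirror-≣ false (var x)  = ≣-refl
pushMirror-≣ true  (var x)  = ≣-refl
pushMirror-≣ false 𝟘        = ≣-refl
pushMirror-≣ true  𝟘        = ≣-sym conv-𝟘
pushMirror-≣ false (e ⊕ f)  = ⊕-cong (pushMirror-≣ false e) (pushMirror-≣ false f)
pushMirror-≣ true  (e ⊕ f)  =
  ≣-trans (⊕-cong (pushMirror-≣ true e) (pushMirror-≣ true f)) (≣-sym (conv-⊕ e f))
pushMirror-≣ false (e ⊙ f)  = ⊙-cong (pushMirror-≣ false e) (pushMirror-≣ false f)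
pushMirror-≣ true  (e ⊙ f)  =
  ≣-trans (⊙-cong (pushMirror-≣ true f) (pushMirror-≣ true e)) (≣-sym (conv-⊙ e f))
pushMirror-≣ false (e ⊓ f)  = ⊓-cong (pushMirror-≣ false e) (pushMirror-≣ false f)
pushMirror-≣ true  (e ⊓ f)  =
  ≣-trans (⊓-cong (pushMirror-≣ true e) (pushMirror-≣ true f)) (≣-sym (conv-⊓ e f))
pushMirror-≣ false (e ⁺)    = ⁺-cong (pushMirror-≣ false e)
pushMirror-≣ true  (e ⁺)    = ≣-trans (⁺-cong (pushMirror-≣ true e)) (≣-sym (conv-⁺ e))
pushMirror-≣ false (conv e) = pushMirror-≣ true e
pushMirror-≣ true  (conv e) = ≣-trans (pushMirror-≣ false e) (≣-sym (conv-inv e))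

-- Interval models

Model : Set → Set₁
Model X = Literal X → ℕ → ℕ → Set

Increasing : (ℕ → ℕ → Set) → Set
Increasing R = ∀ {p q} → R p q → p < q

Plus : (ℕ → ℕ → Set) → ℕ → ℕ → Set
Plus R p q = ∃ λ m → R p m × Star R m q

Rel : Model X → Core X → ℕ → ℕ → Set
Rel ρ (lit y) p q = ρ y p q
Rel ρ ∅       p q = ⊥
Rel ρ (f ∪ g) p q = Rel ρ f p q ⊎ Rel ρ g p q
Rel ρ (f ∙ g) p q = ∃ λ m → Rel ρ f p m × Rel ρ g m q
Rel ρ (f ∩ g) p q = Rel ρ f p q × Rel ρ g p q
Rel ρ (f ₊)   p q = Plus (Rel ρ f) p q

Star-≤ : {R : ℕ → ℕ → Set} → Increasing R → ∀ {p q} → Star R p q → p ≤ q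
Star-≤ inc ε        = ≤-refl
Star-≤ inc (x ◅ xs) = ≤-trans (<⇒≤ (inc x)) (Star-≤ inc xs)

-- No operation produces a unit, so every path has at least one edge and strictness passes from
-- literals to all expressions.
Rel-< : {ρ : Model X} → (∀ y → Increasing (ρ y)) → ∀ f → Increasing (Rel ρ f)
Rel-< inc (lit y) x            = inc y x
Rel-< inc (f ∪ g) (inj₁ x)     = Rel-< inc f x
Rel-< inc (f ∪ g) (inj₂ y)     = Rel-< inc g y
Rel-< inc (f ∙ g) (m , x , y)  = <-trans (Rel-< inc f x) (Rel-< inc g y)
Rel-< inc (f ∩ g) (x , y)      = Rel-< inc f x
Rel-< inc (f ₊)   (m , x , xs) = <-≤-trans (Rel-< inc f x) (Star-≤ (Rel-< inc f) xs)

-- Interval models as language models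

-- Every step of an interval is spelled with two letters, so that a word
-- W p q with p < q is never the mirror image of another such word.
steps : ℕ → ℕ → List (ℕ × Bool)
steps p zero    = []
steps p (suc n) = (p , false) ∷ (p , true) ∷ steps (suc p) n

W : ℕ → ℕ → List (ℕ × Bool)
W p q = steps p (q ∸ p)

reverseIf : Bool → List A → List A
reverseIf false w = w
reverseIf true  w = reverse w

steps-++ : ∀ p m n → steps p (m + n) ≡ steps p m ++ steps (p + m) n
steps-++ p zero    n = cong (λ k → steps k n) (sym (+-identityʳ p))
steps-++ p (suc m) n =
  cong (λ w → (p , false) ∷ (p , true) ∷ w)
    (trans (steps-++ (suc p) m n) (cong (λ k → steps (suc p) m ++ steps k n) (sym (+-suc p m))))

W-++ : ∀ {p m q} → p ≤ m → m ≤ q → W p q ≡ W p m ++ W m q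
W-++ {p} {m} {q} p≤m m≤q =
  trans (cong (steps p) eq)
    (trans (steps-++ p (m ∸ p) (q ∸ m)) (cong (λ k → W p m ++ steps k (q ∸ m)) (m+[n∸m]≡n p≤m)))
  where
  eq : q ∸ p ≡ (m ∸ p) + (q ∸ m)
  eq = trans (cong (_∸ p) (sym (m+[n∸m]≡n m≤q)))
         (trans (cong (_∸ p) (+-comm m (q ∸ m)))
           (trans (+-∸-assoc (q ∸ m) p≤m) (+-comm (q ∸ m) (m ∸ p))))

-- Two letters spell one step, so a prefix of even length ends at a vertex. All words of the model
-- have positive even length, hence every factorisation met below splits an interval at an inner
-- vertex.
data EvenLength⁺ {A : Set} : List A → Set where
  two  : ∀ {a b} → EvenLength⁺ (a ∷ b ∷ [])
  step : ∀ {a b w} → EvenLength⁺ w → EvenLength⁺ (a ∷ b ∷ w)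

EvenLength⁺-++ : {u v : List A} → EvenLength⁺ u → EvenLength⁺ v → EvenLength⁺ (u ++ v)
EvenLength⁺-++ two      y = step y
EvenLength⁺-++ (step x) y = step (EvenLength⁺-++ x y)

pow1-even : {L : Lang A} → (∀ w → L w → EvenLength⁺ w) → ∀ n w → pow1 L n w → EvenLength⁺ w
pow1-even even zero    w x = even w x
pow1-even even (suc n) _ (u , v , refl , x , y) =
  EvenLength⁺-++ (even u x) (pow1-even even n v y)

EvenLength⁺-reverse : {w : List A} → EvenLength⁺ w → EvenLength⁺ (reverse w)
EvenLength⁺-reverse two = two
EvenLength⁺-reverse (step {a} {b} {w} x) =
  subst EvenLength⁺ (sym (reverse-++ (a ∷ b ∷ []) w)) (EvenLength⁺-++ (EvenLength⁺-reverse x) two)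

steps-even : ∀ p n → 0 < n → EvenLength⁺ (steps p n)
steps-even p (suc zero)    _ = two
steps-even p (suc (suc n)) _ = step (steps-even (suc p) (suc n) (s≤s z≤n))

steps-even⁻ : ∀ p n → EvenLength⁺ (steps p n) → 0 < n
steps-even⁻ p (suc n) _ = s≤s z≤n

steps-split : ∀ {u v} p n → EvenLength⁺ u → steps p n ≡ u ++ v →
              ∃ λ k → 0 < k × u ≡ steps p k × v ≡ steps (p + k) (n ∸ k)
steps-split p (suc n) two refl =
  1 , s≤s z≤n , refl , cong (λ k → steps k n) (sym (+-comm p 1))
steps-split {_ ∷ _ ∷ u} p (suc n) (step x) eq
  with steps-split (suc p) n x (∷-injectiveʳ (∷-injectiveʳ eq))
     | ∷-injectiveˡ eq | ∷-injectiveˡ (∷-injectiveʳ eq)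
... | k , _ , refl , v≡ | refl | refl =
  suc k , s≤s z≤n , refl , trans v≡ (cong (λ j → steps j (n ∸ k)) (sym (+-suc p k)))

W-split : ∀ {u v} p q → EvenLength⁺ u → EvenLength⁺ v → W p q ≡ u ++ v →
          ∃ λ m → p < m × m < q × u ≡ W p m × v ≡ W m q
W-split {u} {v} p q x y eq with steps-split p (q ∸ p) x eq
... | k , 0<k , u≡ , v≡ =
  p + k , m<m+n p 0<k ,
  m∸n≢0⇒n<m (λ z → <-irrefl (sym z) (steps-even⁻ (p + k) _ (subst EvenLength⁺ v≡′ y))) ,
  trans u≡ (cong (steps p) (sym (m+n∸m≡n p k))) , v≡′
  where
  v≡′ : v ≡ W (p + k) q
  v≡′ = trans v≡ (cong (steps (p + k)) (∸-+-assoc q p k))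

-- Reversal reduces this to `W-split` with the two factors exchanged.
W-splitʳ : ∀ {u v} p q → EvenLength⁺ u → EvenLength⁺ v → reverse (W p q) ≡ u ++ v →
           ∃ λ m → p < m × m < q × u ≡ reverse (W m q) × v ≡ reverse (W p m)
W-splitʳ {u} {v} p q x y eq
  with W-split p q (EvenLength⁺-reverse y) (EvenLength⁺-reverse x)
         (trans (sym (reverse-involutive (W p q))) (trans (cong reverse eq) (reverse-++ u v)))
... | m , p<m , m<q , v≡ , u≡ =
  m , p<m , m<q ,
  trans (sym (reverse-involutive u)) (cong reverse u≡) ,
  trans (sym (reverse-involutive v)) (cong reverse v≡)

steps-injective : ∀ {p p′} n n′ → steps p n ≡ steps p′ n′ → n ≡ n′
steps-injective zero    zero     eq = refl
steps-injective (suc n) (suc n′) eq =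
  cong suc (steps-injective n n′ (∷-injectiveʳ (∷-injectiveʳ eq)))

W-injective : ∀ {p q p′ q′} → p < q → p′ < q′ → W p q ≡ W p′ q′ → p ≡ p′ × q ≡ q′
W-injective {p} {q} {p′} {q′} p<q p′<q′ eq =
  p≡p′ ,
  trans (sym (m+[n∸m]≡n (<⇒≤ p<q)))
    (trans (cong₂ _+_ p≡p′ (steps-injective (q ∸ p) (q′ ∸ p′) eq)) (m+[n∸m]≡n (<⇒≤ p′<q′)))
  where
  head≡ : ∀ n n′ → 0 < n → 0 < n′ → steps p n ≡ steps p′ n′ → p ≡ p′
  head≡ (suc n) (suc n′) _ _ eq = cong proj₁ (∷-injectiveˡ eq)
  p≡p′ : p ≡ p′
  p≡p′ = head≡ (q ∸ p) (q′ ∸ p′) (m<n⇒0<n∸m p<q) (m<n⇒0<n∸m p′<q′) eq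

-- The first letter reveals the orientation: it is tagged `true` in a reversed nonempty run and
-- `false` in an unreversed one.
reverse-steps-head : ∀ p n → ∃₂ λ k w → reverse (steps p (suc n)) ≡ (k , true) ∷ w
reverse-steps-head p zero = p , _ , refl
reverse-steps-head p (suc n) with reverse-steps-head (suc p) n
... | k , w , eq =
  k , _ , trans (reverse-++ ((p , false) ∷ (p , true) ∷ []) (steps (suc p) (suc n)))
            (cong (_++ (p , true) ∷ (p , false) ∷ []) eq)

steps≢reverse : ∀ {p p′} n n′ → 0 < n → 0 < n′ → steps p n ≡ reverse (steps p′ n′) → ⊥
steps≢reverse {p} {p′} (suc n) (suc n′) _ _ eq with reverse-steps-head p′ n′
... | k , w , eq′ with trans eq eq′
...   | ()

reverseIf-W-injective : ∀ b b′ {p q p′ q′} → p < q → p′ < q′ →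
                        reverseIf b (W p q) ≡ reverseIf b′ (W p′ q′) →
                        b ≡ b′ × p ≡ p′ × q ≡ q′
reverseIf-W-injective false false l l′ eq = refl , W-injective l l′ eq
reverseIf-W-injective false true  l l′ eq =
  ⊥-elim (steps≢reverse _ _ (m<n⇒0<n∸m l) (m<n⇒0<n∸m l′) eq)
reverseIf-W-injective true  false l l′ eq =
  ⊥-elim (steps≢reverse _ _ (m<n⇒0<n∸m l′) (m<n⇒0<n∸m l) (sym eq))
reverseIf-W-injective true  true  l l′ eq = refl , W-injective l l′ (reverse-injective eq)

module _ {L : Lang (ℕ × Bool)} {R : ℕ → ℕ → Set} where

  module _ (inc : Increasing R) where

    Star⇒plusL : (∀ {p q} → R p q → L (W p q)) →
                 ∀ {p m q} → R p m → Star R m q → plusL L (W p q)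
    Star⇒plusL f x ε = 0 , f x
    Star⇒plusL f x (y ◅ ys) with Star⇒plusL f y ys
    ... | n , z = suc n , _ , _ ,
      W-++ (<⇒≤ (inc x)) (≤-trans (<⇒≤ (inc y)) (Star-≤ inc ys)) , f x , z

    Star⇒plusLʳ : (∀ {p q} → R p q → L (reverse (W p q))) →
                  ∀ {p m q} → R p m → Star R m q → plusL L (reverse (W p q))
    Star⇒plusLʳ f x ε = 0 , f x
    Star⇒plusLʳ f {p} {m} {q} x (y ◅ ys) =
      -- In the reversed word the first edge of the path becomes the last factor.
      plusL-snoc _ (_ , _ ,
        trans (cong reverse (W-++ (<⇒≤ (inc x)) (≤-trans (<⇒≤ (inc y)) (Star-≤ inc ys))))
              (reverse-++ (W p m) (W m q)) ,
        Star⇒plusLʳ f y ys , f x)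

  module _ (even : ∀ w → L w → EvenLength⁺ w) where

    pow1⇒Plus : (∀ {p q} → p < q → L (W p q) → R p q) →
                ∀ n {p q} → p < q → pow1 L n (W p q) → Plus R p q
    pow1⇒Plus f zero    p<q x = _ , f p<q x , ε
    pow1⇒Plus f (suc n) {p} {q} p<q (u , v , eq , x , y)
      with W-split p q (even u x) (pow1-even even n v y) eq
    ... | m , p<m , m<q , refl , refl with pow1⇒Plus f n m<q y
    ...   | _ , z , zs = m , f p<m x , z ◅ zs

    pow1⇒Plusʳ : (∀ {p q} → p < q → L (reverse (W p q)) → R p q) →
                 ∀ n {p q} → p < q → pow1 L n (reverse (W p q)) → Plus R p q
    pow1⇒Plusʳ f zero    p<q x = _ , f p<q x , ε
    pow1⇒Plusʳ f (suc n) {p} {q} p<q (u , v , eq , x , y)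
      with W-splitʳ p q (even u x) (pow1-even even n v y) eq
    ... | m , p<m , m<q , refl , refl with pow1⇒Plusʳ f n p<m y
    ...   | k , z , zs = k , z , zs ◅◅ (f m<q x ◅ ε)

module _ {X : Set} (ρ : Model X) (inc : ∀ y → Increasing (ρ y)) where

  -- An edge for a mirrored literal puts the reversed word into the language of the variable, so the
  -- mirrored language contains the word of the interval itself.
  wordModel : X → Lang (ℕ × Bool)
  wordModel x w = ∃ λ b → ∃₂ λ p q → ρ (x , b) p q × w ≡ reverseIf b (W p q)

  wordModel-even : ∀ e w → ⟦ e ⟧ wordModel w → EvenLength⁺ w
  wordModel-even (var x) _ (false , p , q , r , refl) = steps-even p _ (m<n⇒0<n∸m (inc _ r))
  wordModel-even (var x) _ (true , p , q , r , refl) =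
    EvenLength⁺-reverse (steps-even p _ (m<n⇒0<n∸m (inc _ r)))
  wordModel-even (e ⊕ f) w (inj₁ x) = wordModel-even e w x
  wordModel-even (e ⊕ f) w (inj₂ y) = wordModel-even f w y
  wordModel-even (e ⊙ f) _ (u , v , refl , x , y) =
    EvenLength⁺-++ (wordModel-even e u x) (wordModel-even f v y)
  wordModel-even (e ⊓ f) w (x , y) = wordModel-even e w x
  wordModel-even (e ⁺) w (n , x) = pow1-even (wordModel-even e) n w x
  wordModel-even (conv e) _ (u , x , refl) = EvenLength⁺-reverse (wordModel-even e u x)

  private
    inc′ : ∀ b e → Increasing (Rel ρ (pushMirror b e))
    inc′ b e = Rel-< inc (pushMirror b e)

  -- Both orientations share one induction, as `conv` flips the Boolean. For `true`, reversing the
  -- word exchanges the factors just as `pushMirror` does.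
  Rel⇒⟦⟧ : ∀ b e {p q} → Rel ρ (pushMirror b e) p q → ⟦ e ⟧ wordModel (reverseIf b (W p q))
  Rel⇒⟦⟧ b (var x) r = b , _ , _ , r , refl
  Rel⇒⟦⟧ b (e ⊕ f) (inj₁ x) = inj₁ (Rel⇒⟦⟧ b e x)
  Rel⇒⟦⟧ b (e ⊕ f) (inj₂ y) = inj₂ (Rel⇒⟦⟧ b f y)
  Rel⇒⟦⟧ false (e ⊙ f) (m , x , y) =
    _ , _ , W-++ (<⇒≤ (inc′ false e x)) (<⇒≤ (inc′ false f y)) ,
    Rel⇒⟦⟧ false e x , Rel⇒⟦⟧ false f y
  Rel⇒⟦⟧ true (e ⊙ f) {p} {q} (m , y , x) =
    _ , _ ,
    trans (cong reverse (W-++ (<⇒≤ (inc′ true f y)) (<⇒≤ (inc′ true e x))))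
          (reverse-++ (W p m) (W m q)) ,
    Rel⇒⟦⟧ true e x , Rel⇒⟦⟧ true f y
  Rel⇒⟦⟧ b (e ⊓ f) (x , y) = Rel⇒⟦⟧ b e x , Rel⇒⟦⟧ b f y
  Rel⇒⟦⟧ false (e ⁺) (m , x , xs) = Star⇒plusL (inc′ false e) (Rel⇒⟦⟧ false e) x xs
  Rel⇒⟦⟧ true (e ⁺) (m , x , xs) = Star⇒plusLʳ (inc′ true e) (Rel⇒⟦⟧ true e) x xs
  Rel⇒⟦⟧ false (conv e) {p} {q} x =
    reverse (W p q) , Rel⇒⟦⟧ true e x , sym (reverse-involutive (W p q))
  Rel⇒⟦⟧ true (conv e) {p} {q} x = W p q , Rel⇒⟦⟧ false e x , refl

  -- By `p < q` the word is nonempty and determines its interval and orientation, which settles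
  -- variables; at compositions `wordModel-even` forces a split at a vertex.
  ⟦⟧⇒Rel : ∀ b e {p q} → p < q → ⟦ e ⟧ wordModel (reverseIf b (W p q)) → Rel ρ (pushMirror b e) p q
  ⟦⟧⇒Rel b (var x) p<q (b′ , p′ , q′ , r , eq)
    with reverseIf-W-injective b b′ p<q (inc _ r) eq
  ... | refl , refl , refl = r
  ⟦⟧⇒Rel b (e ⊕ f) p<q (inj₁ x) = inj₁ (⟦⟧⇒Rel b e p<q x)
  ⟦⟧⇒Rel b (e ⊕ f) p<q (inj₂ y) = inj₂ (⟦⟧⇒Rel b f p<q y)
  ⟦⟧⇒Rel false (e ⊙ f) {p} {q} p<q (u , v , eq , x , y)
    with W-split p q (wordModel-even e u x) (wordModel-even f v y) eq
  ... | m , p<m , m<q , refl , refl = m , ⟦⟧⇒Rel false e p<m x , ⟦⟧⇒Rel false f m<q y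
  ⟦⟧⇒Rel true (e ⊙ f) {p} {q} p<q (u , v , eq , x , y)
    with W-splitʳ p q (wordModel-even e u x) (wordModel-even f v y) eq
  ... | m , p<m , m<q , refl , refl = m , ⟦⟧⇒Rel true f p<m y , ⟦⟧⇒Rel true e m<q x
  ⟦⟧⇒Rel b (e ⊓ f) p<q (x , y) = ⟦⟧⇒Rel b e p<q x , ⟦⟧⇒Rel b f p<q y
  ⟦⟧⇒Rel false (e ⁺) p<q (n , x) = pow1⇒Plus (wordModel-even e) (⟦⟧⇒Rel false e) n p<q x
  ⟦⟧⇒Rel true (e ⁺) p<q (n , x) = pow1⇒Plusʳ (wordModel-even e) (⟦⟧⇒Rel true e) n p<q x
  ⟦⟧⇒Rel false (conv e) p<q (u , x , eq) =
    ⟦⟧⇒Rel true e p<q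
      (subst (⟦ e ⟧ wordModel) (trans (sym (reverse-involutive u)) (cong reverse (sym eq))) x)
  ⟦⟧⇒Rel true (conv e) p<q (u , x , eq) =
    ⟦⟧⇒Rel false e p<q (subst (⟦ e ⟧ wordModel) (sym (reverse-injective eq)) x)

-- Series-parallel terms and their placement on the line

data Term (X : Set) : Set where
  leaf    : Literal X → Term X
  ser par : Term X → Term X → Term X

infix 4 _∈ᵀ_
data _∈ᵀ_ {X : Set} : Term X → Core X → Set where
  leaf : ∀ {y} → leaf y ∈ᵀ lit y
  inl  : ∀ {t f g} → t ∈ᵀ f → t ∈ᵀ f ∪ g
  inr  : ∀ {t f g} → t ∈ᵀ g → t ∈ᵀ f ∪ g
  ser  : ∀ {t u f g} → t ∈ᵀ f → u ∈ᵀ g → ser t u ∈ᵀ f ∙ g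
  par  : ∀ {t u f g} → t ∈ᵀ f → u ∈ᵀ g → par t u ∈ᵀ f ∩ g
  one  : ∀ {t f} → t ∈ᵀ f → t ∈ᵀ f ₊
  more : ∀ {t u f} → t ∈ᵀ f → u ∈ᵀ f ₊ → ser t u ∈ᵀ f ₊

-- The number of inner vertices.
size : Term X → ℕ
size (leaf y)  = 0
size (ser t u) = size t + suc (size u)
size (par t u) = size t + size u

-- The edges of t drawn from i to j, with inner vertices s, s + 1, ..., s + size t - 1.
edges : Term X → (i s j : ℕ) → Model X
edges (leaf x)  i s j y p q = y ≡ x × p ≡ i × q ≡ j
edges (ser t u) i s j y p q =
  edges t i s (s + size t) y p q ⊎ edges u (s + size t) (suc (s + size t)) j y p q
edges (par t u) i s j y p q = edges t i s j y p q ⊎ edges u i (s + size t) j y p q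

-- Allowing any model that contains the edges lets the induction hypothesis apply to a component
-- inside the larger drawing.
edges⇒Rel : ∀ {t : Term X} {f ρ i s j} → t ∈ᵀ f → (∀ {y p q} → edges t i s j y p q → ρ y p q) →
            Rel ρ f i j
edges⇒Rel leaf       h = h (refl , refl , refl)
edges⇒Rel (inl x)    h = inj₁ (edges⇒Rel x h)
edges⇒Rel (inr x)    h = inj₂ (edges⇒Rel x h)
edges⇒Rel (ser x y)  h = _ , edges⇒Rel x (h ∘ inj₁) , edges⇒Rel y (h ∘ inj₂)
edges⇒Rel (par x y)  h = edges⇒Rel x (h ∘ inj₁) , edges⇒Rel y (h ∘ inj₂)
edges⇒Rel (one x)    h = _ , edges⇒Rel x h , ε
edges⇒Rel (more x y) h with edges⇒Rel y (h ∘ inj₂)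
... | _ , z , zs = _ , edges⇒Rel x (h ∘ inj₁) , z ◅ zs

-- Vertices of a placed term

Within : ℕ → ℕ → ℕ → Set
Within s n p = s ≤ p × p < s + n

Within-ˡ : ∀ {s m n p} → Within s m p → Within s (m + n) p
Within-ˡ {s} {m} {n} (a , b) = a , <-≤-trans b (+-monoʳ-≤ s (m≤m+n m n))

Within-ʳ : ∀ {s m n p} → Within (s + m) n p → Within s (m + n) p
Within-ʳ {s} {m} {n} {p} (a , b) = ≤-trans (m≤m+n s m) a , subst (p <_) (+-assoc s m n) b

Within-middle : ∀ {s m n} → Within s (m + suc n) (s + m)
Within-middle {s} {m} {n} = m≤m+n s m , +-monoʳ-< s (m<m+n m (s≤s z≤n))

Within-suc : ∀ {s n p} → Within (suc s) n p → Within s (suc n) p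
Within-suc {s} {n} {p} (a , b) = <⇒≤ a , subst (p <_) (sym (+-suc s n)) b

edges-vertices : ∀ (t : Term X) {i s j y p q} → edges t i s j y p q →
                 (p ≡ i ⊎ Within s (size t) p) × (q ≡ j ⊎ Within s (size t) q)
edges-vertices (leaf x) (_ , a , b) = inj₁ a , inj₁ b
edges-vertices (ser t u) {s = s} (inj₁ x) with edges-vertices t x
... | a , b = Sum.map₂ Within-ˡ a , inj₂ ([ (λ { refl → Within-middle {s} }) , Within-ˡ ]′ b)
edges-vertices (ser t u) {s = s} (inj₂ x) with edges-vertices u x
... | a , b =
  inj₂ ([ (λ { refl → Within-middle {s} }) , Within-ʳ ∘ Within-suc ]′ a) ,
  Sum.map₂ (Within-ʳ ∘ Within-suc) b
edges-vertices (par t u) (inj₁ x) with edges-vertices t x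
... | a , b = Sum.map₂ Within-ˡ a , Sum.map₂ Within-ˡ b
edges-vertices (par t u) (inj₂ x) with edges-vertices u x
... | a , b = Sum.map₂ Within-ʳ a , Sum.map₂ Within-ʳ b

-- The ends enclose the block of inner vertices. The last of these is `s + size t - 1`, so the upper
-- bound need not be strict.
Fits : Term X → (i s j : ℕ) → Set
Fits t i s j = i < s × s + size t ≤ j

fits-serˡ : ∀ (t u : Term X) {i s j} → Fits (ser t u) i s j → Fits t i s (s + size t)
fits-serˡ t u (a , b) = a , ≤-refl

fits-serʳ : ∀ (t u : Term X) {i s j} → Fits (ser t u) i s j →
            Fits u (s + size t) (suc (s + size t)) j
fits-serʳ t u {i} {s} {j} (a , b) =
  ≤-refl ,
  subst (_≤ j) (trans (sym (+-assoc s (size t) (suc (size u)))) (+-suc (s + size t) (size u))) b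

fits-parˡ : ∀ (t u : Term X) {i s j} → Fits (par t u) i s j → Fits t i s j
fits-parˡ t u {s = s} (a , b) = a , ≤-trans (+-monoʳ-≤ s (m≤m+n (size t) (size u))) b

fits-parʳ : ∀ (t u : Term X) {i s j} → Fits (par t u) i s j → Fits u i (s + size t) j
fits-parʳ t u {s = s} {j} (a , b) =
  <-≤-trans a (m≤m+n s (size t)) , subst (_≤ j) (sym (+-assoc s (size t) (size u))) b

fits-< : ∀ (t : Term X) {i s j} → Fits t i s j → i < j
fits-< t {s = s} (a , b) = <-≤-trans a (≤-trans (m≤m+n s (size t)) b)

edges-< : ∀ (t : Term X) {i s j} → Fits t i s j → ∀ y → Increasing (edges t i s j y)
edges-< (leaf x) F y (_ , refl , refl) = fits-< (leaf x) F
edges-< (ser t u) F y (inj₁ x) = edges-< t (fits-serˡ t u F) y x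
edges-< (ser t u) F y (inj₂ x) = edges-< u (fits-serʳ t u F) y x
edges-< (par t u) F y (inj₁ x) = edges-< t (fits-parˡ t u F) y x
edges-< (par t u) F y (inj₂ x) = edges-< u (fits-parʳ t u F) y x

edges-≥ : ∀ (t : Term X) {i s j y p q} → Fits t i s j → edges t i s j y p q → i ≤ p
edges-≥ t (a , _) x with proj₁ (edges-vertices t x)
... | inj₁ refl    = ≤-refl
... | inj₂ (b , _) = ≤-trans (<⇒≤ a) b

edges-≤ : ∀ (t : Term X) {i s j y p q} → Fits t i s j → edges t i s j y p q → q ≤ j
edges-≤ t (_ , a) x with proj₂ (edges-vertices t x)
... | inj₁ refl    = ≤-refl
... | inj₂ (_ , b) = ≤-trans (<⇒≤ b) a

-- Restriction of models

module _ {X : Set} {ρ ρ′ : Model X} (inc : ∀ y → Increasing (ρ y)) (D : ℕ → Set) where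

  module _ {i : ℕ}
    (back : ∀ {y p q} → i ≤ p → D q → ρ y p q → ρ′ y p q × (i < p → D p)) where

    -- A path ending in `D` is traced backwards: `back` keeps each edge in `ρ′` and its source in
    -- `D` until `i` is reached. Hence the second factor of a composition is treated first.
    Rel-restrictˡ : ∀ f {p q} → i ≤ p → D q → Rel ρ f p q → Rel ρ′ f p q × (i < p → D p)
    Star-restrictˡ : ∀ f {p q} → i < p → D q → Star (Rel ρ f) p q → Star (Rel ρ′ f) p q × D p

    Rel-restrictˡ (lit y) i≤p d x = back i≤p d x
    Rel-restrictˡ (f ∪ g) i≤p d (inj₁ x) with Rel-restrictˡ f i≤p d x
    ... | x′ , e = inj₁ x′ , e
    Rel-restrictˡ (f ∪ g) i≤p d (inj₂ x) with Rel-restrictˡ g i≤p d x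
    ... | x′ , e = inj₂ x′ , e
    Rel-restrictˡ (f ∙ g) i≤p d (m , x , y) with ≤-<-trans i≤p (Rel-< inc f x)
    ... | i<m with Rel-restrictˡ g (<⇒≤ i<m) d y
    ...   | y′ , e with Rel-restrictˡ f i≤p (e i<m) x
    ...     | x′ , e′ = (m , x′ , y′) , e′
    Rel-restrictˡ (f ∩ g) i≤p d (x , y) with Rel-restrictˡ f i≤p d x
    ... | x′ , e = (x′ , proj₁ (Rel-restrictˡ g i≤p d y)) , e
    Rel-restrictˡ (f ₊) i≤p d (m , x , xs)
      with Star-restrictˡ f (≤-<-trans i≤p (Rel-< inc f x)) d xs
    ... | xs′ , e with Rel-restrictˡ f i≤p e x
    ...   | x′ , e′ = (m , x′ , xs′) , e′

    Star-restrictˡ f i<p d ε = ε , d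
    Star-restrictˡ f i<p d (x ◅ xs) with Star-restrictˡ f (<-trans i<p (Rel-< inc f x)) d xs
    ... | xs′ , e with Rel-restrictˡ f (<⇒≤ i<p) e x
    ...   | x′ , e′ = x′ ◅ xs′ , e′ i<p

  module _ {j : ℕ}
    (forth : ∀ {y p q} → q ≤ j → D p → ρ y p q → ρ′ y p q × (q < j → D q)) where

    -- Dually, a path starting in `D` is traced forwards. In an iteration the last factor is treated
    -- apart, because it may end at `j`, which need not lie in `D`.
    Rel-restrictʳ : ∀ f {p q} → q ≤ j → D p → Rel ρ f p q → Rel ρ′ f p q × (q < j → D q)
    Star-restrictʳ : ∀ f {p m q} → q ≤ j → D p → Rel ρ f p m → Star (Rel ρ f) m q →
                     Plus (Rel ρ′ f) p q × (q < j → D q)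

    Rel-restrictʳ (lit y) q≤j d x = forth q≤j d x
    Rel-restrictʳ (f ∪ g) q≤j d (inj₁ x) with Rel-restrictʳ f q≤j d x
    ... | x′ , e = inj₁ x′ , e
    Rel-restrictʳ (f ∪ g) q≤j d (inj₂ x) with Rel-restrictʳ g q≤j d x
    ... | x′ , e = inj₂ x′ , e
    Rel-restrictʳ (f ∙ g) q≤j d (m , x , y) with <-≤-trans (Rel-< inc g y) q≤j
    ... | m<j with Rel-restrictʳ f (<⇒≤ m<j) d x
    ...   | x′ , e with Rel-restrictʳ g q≤j (e m<j) y
    ...     | y′ , e′ = (m , x′ , y′) , e′
    Rel-restrictʳ (f ∩ g) q≤j d (x , y) with Rel-restrictʳ f q≤j d x
    ... | x′ , e = (x′ , proj₁ (Rel-restrictʳ g q≤j d y)) , e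
    Rel-restrictʳ (f ₊) q≤j d (m , x , xs) = Star-restrictʳ f q≤j d x xs

    Star-restrictʳ f q≤j d x ε with Rel-restrictʳ f q≤j d x
    ... | x′ , e = (_ , x′ , ε) , e
    Star-restrictʳ f {m = m} q≤j d x (y ◅ ys)
      with <-≤-trans (<-≤-trans (Rel-< inc f y) (Star-≤ (Rel-< inc f) ys)) q≤j
    ... | m<j with Rel-restrictʳ f (<⇒≤ m<j) d x
    ...   | x′ , e with Star-restrictʳ f q≤j (e m<j) y ys
    ...     | (_ , z , zs) , e′ = (m , x′ , z ◅ zs) , e′

-- Every path ends with an edge; for the first part of a composite path this edge tells in which
-- branch of a parallel composition the middle vertex lies.
Rel-target : ∀ {ρ : Model X} f {p q} → Rel ρ f p q → ∃₂ λ y p′ → ρ y p′ q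
Star-target : ∀ {ρ : Model X} f {p m q} → Rel ρ f p m → Star (Rel ρ f) m q → ∃₂ λ y p′ → ρ y p′ q
Rel-target (lit y) x            = y , _ , x
Rel-target (f ∪ g) (inj₁ x)     = Rel-target f x
Rel-target (f ∪ g) (inj₂ x)     = Rel-target g x
Rel-target (f ∙ g) (m , x , y)  = Rel-target g y
Rel-target (f ∩ g) (x , y)      = Rel-target f x
Rel-target (f ₊)   (m , x , xs) = Star-target f x xs
Star-target f x ε        = Rel-target f x
Star-target f x (y ◅ ys) = Star-target f y ys

-- Segments of an expression

-- In Segment (f ₊), suf u, pre v, seg u v and iter stand for u·f*, f*·v, u·f*·v and f⁺.
data Segment {X : Set} : Core X → Set where
  atom : ∀ {y} → Segment (lit y)
  none : Segment ∅
  inl  : ∀ {o f g} → Segment f → Segment (bin o f g)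
  inr  : ∀ {o f g} → Segment g → Segment (bin o f g)
  both : ∀ {o f g} → Segment f → Segment g → Segment (bin o f g)
  one  : ∀ {f} → Segment f → Segment (f ₊)
  suf  : ∀ {f} → Segment f → Segment (f ₊)
  pre  : ∀ {f} → Segment f → Segment (f ₊)
  seg  : ∀ {f} → Segment f → Segment f → Segment (f ₊)
  iter : ∀ {f} → Segment (f ₊)

-- Without a unit there is no `f*`; `g·f*` and `f*·g` are sums of the cases without and with factors
-- `f`.
starʳ starˡ : Core X → Core X → Core X
starʳ f g = g ∪ g ∙ f ₊
starˡ f g = g ∪ f ₊ ∙ g

core : {f : Core X} → Segment f → Core X
core {f = lit y} atom           = lit y
core none                       = ∅
core (inl u)                    = core u
core (inr v)                    = core v
core (both {o} u v)             = bin o (core u) (core v)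
core (one u)                    = core u
core {f = f ₊} (suf u)          = starʳ f (core u)
core {f = f ₊} (pre v)          = starˡ f (core v)
core {f = f ₊} (seg u v)        = starʳ f (core u) ∙ core v
core {f = f ₊} iter             = f ₊

⟪_⟫ : {f : Core X} → Segment f → Expr X
⟪ s ⟫ = ⌜ core s ⌝

segments : (f : Core X) → List (Segment f)
segments (lit y)     = atom ∷ []
segments ∅           = none ∷ []
segments (bin o f g) =
  map inl (segments f) ++ map inr (segments g) ++
  cartesianProductWith both (segments f) (segments g)
segments (f ₊)       =
  iter ∷ map one (segments f) ++ map suf (segments f) ++ map pre (segments f) ++
  cartesianProductWith seg (segments f) (segments f)

segments-complete : (f : Core X) (s : Segment f) → s ∈ segments f
segments-complete (lit y) atom = here refl
segments-complete ∅ none = here refl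
segments-complete (bin o f g) (inl u) = ∈-++⁺ˡ (∈-map⁺ inl (segments-complete f u))
segments-complete (bin o f g) (inr v) =
  ∈-++⁺ʳ (map inl (segments f)) (∈-++⁺ˡ (∈-map⁺ inr (segments-complete g v)))
segments-complete (bin o f g) (both u v) =
  ∈-++⁺ʳ (map inl (segments f)) (∈-++⁺ʳ (map inr (segments g))
    (∈-cartesianProductWith⁺ both (segments-complete f u) (segments-complete g v)))
segments-complete (f ₊) iter = here refl
segments-complete (f ₊) (one u) = there (∈-++⁺ˡ (∈-map⁺ one (segments-complete f u)))
segments-complete (f ₊) (suf u) =
  there (∈-++⁺ʳ (map one (segments f)) (∈-++⁺ˡ (∈-map⁺ suf (segments-complete f u))))
segments-complete (f ₊) (pre v) =
  there (∈-++⁺ʳ (map one (segments f)) (∈-++⁺ʳ (map suf (segments f))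
    (∈-++⁺ˡ (∈-map⁺ pre (segments-complete f v)))))
segments-complete (f ₊) (seg u v) =
  there (∈-++⁺ʳ (map one (segments f)) (∈-++⁺ʳ (map suf (segments f))
    (∈-++⁺ʳ (map pre (segments f))
      (∈-cartesianProductWith⁺ seg (segments-complete f u) (segments-complete f v)))))

whole : (f : Core X) → Segment f
whole (lit y)     = atom
whole ∅           = none
whole (bin o f g) = both (whole f) (whole g)
whole (f ₊)       = iter

core-whole : (f : Core X) → core (whole f) ≡ f
core-whole (lit y)     = refl
core-whole ∅           = refl
core-whole (bin o f g) = cong₂ (bin o) (core-whole f) (core-whole g)
core-whole (f ₊)       = refl

-- Inequalities for segments of an iteration

module _ {X : Set} {f : Expr X} where

  private
    variable
      l r u v : Expr X

    infix 9 _⋆ʳ ⋆ˡ_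

    _⋆ʳ ⋆ˡ_ : Expr X → Expr X
    g ⋆ʳ = g ⊕ g ⊙ f ⁺
    ⋆ˡ g = g ⊕ f ⁺ ⊙ g

  starʳ-self : f ⋆ʳ ≲ f ⁺
  starʳ-self = ⊕-lub ⁺-base ⁺-cons

  starˡ-self : ⋆ˡ f ≲ f ⁺
  starˡ-self = ⊕-lub ⁺-base (≲-trans (⊙-monoʳ ⁺-base) ⁺-trans)

  starʳ-⁺ : u ⋆ʳ ⊙ f ⁺ ≲ u ⋆ʳ
  starʳ-⁺ {u} =
    ≲-trans (≲-reflexive (⊙-distrʳ u (u ⊙ f ⁺) (f ⁺)))
      (⊕-lub ⊕-upperʳ (≲-trans ⊙-assocʳ (≲-trans (⊙-monoʳ ⁺-trans) ⊕-upperʳ)))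

  starˡ-⁺ : f ⁺ ⊙ ⋆ˡ v ≲ ⋆ˡ v
  starˡ-⁺ {v} =
    ≲-trans (≲-reflexive (⊙-distrˡ (f ⁺) v (f ⁺ ⊙ v)))
      (⊕-lub ⊕-upperʳ (≲-trans ⊙-assocˡ (≲-trans (⊙-monoˡ ⁺-trans) ⊕-upperʳ)))

  starʳ-⊙ : l ⊙ r ≲ u → l ⊙ r ⋆ʳ ≲ u ⋆ʳ
  starʳ-⊙ {l} {r} p =
    ≲-trans (≲-reflexive (⊙-distrˡ l r (r ⊙ f ⁺)))
      (⊕-mono p (≲-trans ⊙-assocˡ (⊙-monoˡ p)))

  starˡ-⊙ : l ⊙ r ≲ v → ⋆ˡ l ⊙ r ≲ ⋆ˡ v
  starˡ-⊙ {l} {r} p =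
    ≲-trans (≲-reflexive (⊙-distrʳ l (f ⁺ ⊙ l) r))
      (⊕-mono p (≲-trans ⊙-assocʳ (⊙-monoʳ p)))

  -- Serves a cut of `seg u v` at a border between factors of its middle iteration.
  starʳ-starˡ : u ⋆ʳ ⊙ ⋆ˡ v ≲ u ⋆ʳ ⊙ v
  starʳ-starˡ {u} {v} =
    ≲-trans (≲-reflexive (⊙-distrˡ (u ⋆ʳ) v (f ⁺ ⊙ v)))
      (⊕-lub ≲-refl (≲-trans ⊙-assocˡ (⊙-monoˡ starʳ-⁺)))

  -- Here and in the next three lemmas the cut falls inside a factor `f`, which breaks into `l` and
  -- `r`, while the factors before and after it stay on their sides.
  iter-split : l ⊙ r ≲ f → ⋆ˡ l ⊙ r ⋆ʳ ≲ f ⁺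
  iter-split p =
    ≲-trans (starʳ-⊙ (≲-trans (starˡ-⊙ p) starˡ-self))
      (⊕-lub ≲-refl ⁺-trans)

  suf-split : l ⊙ r ≲ f → u ⋆ʳ ⊙ l ⊙ r ⋆ʳ ≲ u ⋆ʳ
  suf-split p =
    ≲-trans ⊙-assocʳ (≲-trans (⊙-monoʳ (≲-trans (starʳ-⊙ p) starʳ-self)) starʳ-⁺)

  pre-split : l ⊙ r ≲ f → ⋆ˡ l ⊙ (r ⋆ʳ ⊙ v) ≲ ⋆ˡ v
  pre-split p = ≲-trans ⊙-assocˡ (≲-trans (⊙-monoˡ (iter-split p)) ⊕-upperʳ)

  seg-split : l ⊙ r ≲ f → (u ⋆ʳ ⊙ l) ⊙ (r ⋆ʳ ⊙ v) ≲ u ⋆ʳ ⊙ v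
  seg-split p = ≲-trans ⊙-assocˡ (⊙-monoˡ (suf-split p))

-- Cutting a path at a vertex that no edge jumps over

-- Factors ending at or before `k` are skipped; the next factor, if any, either starts at `k` or
-- straddles it.
Star-cut : {R : ℕ → ℕ → Set} → Increasing R → ∀ {p k q} → p ≤ k → k ≤ q → Star R p q →
           (Star R p k × Star R k q) ⊎
           (∃₂ λ a b → Star R p a × R a b × a < k × k < b × Star R b q)
Star-cut inc p≤k k≤q ε with ≤-antisym p≤k k≤q
... | refl = inj₁ (ε , ε)
Star-cut inc {k = k} p≤k k≤q (_◅_ {j = m} x xs) with k <? m | m≤n⇒m<n∨m≡n p≤k
... | yes k<m | inj₁ p<k  = inj₂ (_ , _ , ε , x , p<k , k<m , xs)
... | yes k<m | inj₂ refl = inj₁ (ε , x ◅ xs)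
... | no  k≮m | _ with Star-cut inc (≮⇒≥ k≮m) k≤q xs
...   | inj₁ (ys , zs) = inj₁ (x ◅ ys , zs)
...   | inj₂ (a , b , ys , y , a<k , k<b , zs) = inj₂ (a , b , x ◅ ys , y , a<k , k<b , zs)

Star⇒Plus : {R : ℕ → ℕ → Set} → ∀ {p q} → p < q → Star R p q → Plus R p q
Star⇒Plus p<p ε        = ⊥-elim (<-irrefl refl p<p)
Star⇒Plus p<q (x ◅ xs) = _ , x , xs

module _ {X : Set} {ρ : Model X} (f g : Core X) where

  starʳ-elim : ∀ {p q} → Rel ρ (starʳ f g) p q → ∃ λ m → Rel ρ g p m × Star (Rel ρ f) m q
  starʳ-elim (inj₁ x)                = _ , x , ε
  starʳ-elim (inj₂ (m , x , _ , y , ys)) = m , x , y ◅ ys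

  starʳ-intro : ∀ {p m q} → Rel ρ g p m → Star (Rel ρ f) m q → Rel ρ (starʳ f g) p q
  starʳ-intro x ε        = inj₁ x
  starʳ-intro x (y ◅ ys) = inj₂ (_ , x , _ , y , ys)

  starˡ-elim : ∀ {p q} → Rel ρ (starˡ f g) p q → ∃ λ m → Star (Rel ρ f) p m × Rel ρ g m q
  starˡ-elim (inj₁ x)                    = _ , ε , x
  starˡ-elim (inj₂ (m , (_ , y , ys) , x)) = m , y ◅ ys , x

  starˡ-intro : ∀ {p m q} → Star (Rel ρ f) p m → Rel ρ g m q → Rel ρ (starˡ f g) p q
  starˡ-intro ε        x = inj₁ x
  starˡ-intro (y ◅ ys) x = inj₂ (_ , (_ , y , ys) , x)

module _ {X : Set} (ρ : Model X) (inc : ∀ y → Increasing (ρ y)) (k : ℕ)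
  (uncrossed : ∀ {y p q} → ρ y p q → p < k → k < q → ⊥) where

  Cut : {f : Core X} → Segment f → ℕ → ℕ → Set
  Cut {f} s p q = ∃₂ λ (l r : Segment f) →
    ⟪ l ⟫ ⊙ ⟪ r ⟫ ≲ ⟪ s ⟫ × Rel ρ (core l) p k × Rel ρ (core r) k q

  -- Both pieces are again segments of the original `f`, not merely of `core s`; this keeps the
  -- supply of segments finite under repeated cutting.
  Rel-cut : ∀ f (s : Segment f) {p q} → p < k → k < q → Rel ρ (core s) p q → Cut s p q

  -- For a factor of an iteration that straddles `k`: such a factor is matched by all of `f`.
  Rel-cut-whole : ∀ f {p q} → p < k → k < q → Rel ρ f p q →
                  ∃₂ λ (l r : Segment f) →
                    ⟪ l ⟫ ⊙ ⟪ r ⟫ ≲ ⌜ f ⌝ × Rel ρ (core l) p k × Rel ρ (core r) k q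
  Rel-cut-whole f {p} {q} p<k k<q x with Rel-cut f (whole f) p<k k<q
                                (subst (λ g → Rel ρ g p q) (sym (core-whole f)) x)
  ... | l , r , le , a , b = l , r , subst (λ g → ⟪ l ⟫ ⊙ ⟪ r ⟫ ≲ ⌜ g ⌝) (core-whole f) le , a , b

  Rel-cut (lit y) atom p<k k<q x = ⊥-elim (uncrossed x p<k k<q)
  Rel-cut (bin o f g) (inl u) p<k k<q x with Rel-cut f u p<k k<q x
  ... | l , r , le , a , b = inl l , inl r , le , a , b
  Rel-cut (bin o f g) (inr v) p<k k<q x with Rel-cut g v p<k k<q x
  ... | l , r , le , a , b = inr l , inr r , le , a , b
  Rel-cut (f ∪ g) (both u v) p<k k<q (inj₁ x) with Rel-cut f u p<k k<q x
  ... | l , r , le , a , b = inl l , inl r , ≲-trans le ⊕-upperˡ , a , b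
  Rel-cut (f ∪ g) (both u v) p<k k<q (inj₂ x) with Rel-cut g v p<k k<q x
  ... | l , r , le , a , b = inr l , inr r , ≲-trans le ⊕-upperʳ , a , b
  Rel-cut (f ∙ g) (both u v) p<k k<q (m , x , y) with <-cmp m k
  ... | tri≈ _ refl _ = inl u , inr v , ≲-refl , x , y
  ... | tri< m<k _ _ with Rel-cut g v m<k k<q y
  ...   | l , r , le , a , b =
    both u l , inr r , ≲-trans ⊙-assocʳ (⊙-monoʳ le) , (m , x , a) , b
  Rel-cut (f ∙ g) (both u v) p<k k<q (m , x , y) | tri> _ _ k<m with Rel-cut f u p<k k<m x
  ...   | l , r , le , a , b =
    inl l , both r v , ≲-trans ⊙-assocˡ (⊙-monoˡ le) , a , (m , b , y)
  -- Both paths are cut at the same vertex. Composition distributes over meets in one direction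
  -- only, which is the direction needed.
  Rel-cut (f ∩ g) (both u v) p<k k<q (x , y) with Rel-cut f u p<k k<q x | Rel-cut g v p<k k<q y
  ... | l , r , le , a , b | l′ , r′ , le′ , a′ , b′ =
    both l l′ , both r r′ ,
    ⊓-glb (≲-trans (⊙-mono ⊓-lowerˡ ⊓-lowerˡ) le) (≲-trans (⊙-mono ⊓-lowerʳ ⊓-lowerʳ) le′) ,
    (a , a′) , (b , b′)
  Rel-cut (f ₊) (one u) p<k k<q x with Rel-cut f u p<k k<q x
  ... | l , r , le , a , b = one l , one r , le , a , b
  Rel-cut (f ₊) iter p<k k<q (m , x , xs)
    with Star-cut (Rel-< inc f) (<⇒≤ p<k) (<⇒≤ k<q) (x ◅ xs)
  ... | inj₁ (ys , zs) = iter , iter , ⁺-trans , Star⇒Plus p<k ys , Star⇒Plus k<q zs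
  ... | inj₂ (_ , _ , ys , y , a<k , k<b , zs) with Rel-cut-whole f a<k k<b y
  ...   | l , r , le , a , b =
    pre l , suf r , iter-split le , starˡ-intro f (core l) ys a , starʳ-intro f (core r) b zs
  Rel-cut (f ₊) (suf u) p<k k<q z with starʳ-elim f (core u) z
  ... | m , x , xs with k <? m
  ...   | yes k<m with Rel-cut f u p<k k<m x
  ...     | l , r , le , a , b =
    one l , suf r , starʳ-⊙ le , a , starʳ-intro f (core r) b xs
  Rel-cut (f ₊) (suf u) p<k k<q z | m , x , xs | no k≮m
    with Star-cut (Rel-< inc f) (≮⇒≥ k≮m) (<⇒≤ k<q) xs
  ...   | inj₁ (ys , zs) =
    suf u , iter , starʳ-⁺ , starʳ-intro f (core u) x ys , Star⇒Plus k<q zs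
  ...   | inj₂ (_ , _ , ys , y , a<k , k<b , zs) with Rel-cut-whole f a<k k<b y
  ...     | l , r , le , a , b =
    seg u l , suf r , suf-split le ,
    (_ , starʳ-intro f (core u) x ys , a) , starʳ-intro f (core r) b zs
  Rel-cut (f ₊) (pre v) p<k k<q z with starˡ-elim f (core v) z
  ... | m , xs , x with m <? k
  ...   | yes m<k with Rel-cut f v m<k k<q x
  ...     | l , r , le , a , b =
    pre l , one r , starˡ-⊙ le , starˡ-intro f (core l) xs a , b
  Rel-cut (f ₊) (pre v) p<k k<q z | m , xs , x | no m≮k
    with Star-cut (Rel-< inc f) (<⇒≤ p<k) (≮⇒≥ m≮k) xs
  ...   | inj₁ (ys , zs) =
    iter , pre v , starˡ-⁺ , Star⇒Plus p<k ys , starˡ-intro f (core v) zs x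
  ...   | inj₂ (_ , _ , ys , y , a<k , k<b , zs) with Rel-cut-whole f a<k k<b y
  ...     | l , r , le , a , b =
    pre l , seg r v , pre-split le ,
    starˡ-intro f (core l) ys a , (_ , starʳ-intro f (core r) b zs , x)
  Rel-cut (f ₊) (seg u v) p<k k<q (m′ , z , y) with starʳ-elim f (core u) z
  -- The vertex `k` lies inside the part of `u`, inside the part of `v`, or on the iteration between
  -- them, ends included.
  ... | m , x , xs with k <? m | m′ <? k
  ...   | yes k<m | _ with Rel-cut f u p<k k<m x
  ...     | l , r , le , a , b =
    one l , seg r v , ≲-trans ⊙-assocˡ (⊙-monoˡ (starʳ-⊙ le)) ,
    a , (m′ , starʳ-intro f (core r) b xs , y)
  Rel-cut (f ₊) (seg u v) p<k k<q (m′ , z , y) | m , x , xs | no _ | yes m′<k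
    with Rel-cut f v m′<k k<q y
  ...     | l , r , le , a , b =
    seg u l , one r , ≲-trans ⊙-assocʳ (⊙-monoʳ le) , (m′ , z , a) , b
  Rel-cut (f ₊) (seg u v) p<k k<q (m′ , z , y) | m , x , xs | no k≮m | no m′≮k
    with Star-cut (Rel-< inc f) (≮⇒≥ k≮m) (≮⇒≥ m′≮k) xs
  ...   | inj₁ (ys , zs) =
    suf u , pre v , starʳ-starˡ , starʳ-intro f (core u) x ys , starˡ-intro f (core v) zs y
  ...   | inj₂ (_ , _ , ys , w , a<k , k<b , zs) with Rel-cut-whole f a<k k<b w
  ...     | l , r , le , a , b =
    seg u l , seg r v , seg-split le ,
    (_ , starʳ-intro f (core u) x ys , a) , (m′ , starʳ-intro f (core r) b zs , y)

-- Splitting along a parallel composition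

-- The only edge goes from `i` to `j` and cannot be chained with itself because `i < j`; this rules
-- out compositions and iterations of two or more factors.
Rel-leaf : ∀ {x : Literal X} {i j} s → i < j → ∀ g {p q} → Rel (edges (leaf x) i s j) g p q →
           p ≡ i × q ≡ j × literal x ≲ ⌜ g ⌝
Rel-leaf s i<j (lit y) (refl , refl , refl) = refl , refl , ≲-refl
Rel-leaf s i<j (f ∪ g) (inj₁ x) with Rel-leaf s i<j f x
... | a , b , le = a , b , ≲-trans le ⊕-upperˡ
Rel-leaf s i<j (f ∪ g) (inj₂ x) with Rel-leaf s i<j g x
... | a , b , le = a , b , ≲-trans le ⊕-upperʳ
Rel-leaf s i<j (f ∙ g) (m , x , y) with Rel-leaf s i<j f x | Rel-leaf s i<j g y
... | _ , refl , _ | refl , _ , _ = ⊥-elim (<-irrefl refl i<j)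
Rel-leaf s i<j (f ∩ g) (x , y) with Rel-leaf s i<j f x | Rel-leaf s i<j g y
... | a , b , le | _ , _ , le′ = a , b , ⊓-glb le le′
Rel-leaf s i<j (f ₊) (m , x , ε) with Rel-leaf s i<j f x
... | a , b , le = a , b , ≲-trans le ⁺-base
Rel-leaf s i<j (f ₊) (m , x , y ◅ ys) with Rel-leaf s i<j f x | Rel-leaf s i<j f y
... | _ , refl , _ | refl , _ , _ = ⊥-elim (<-irrefl refl i<j)

module _ {X : Set} (t u : Term X) {i s j : ℕ} (F : Fits (par t u) i s j) where

  private
    c = s + size t
    ρ = edges (par t u) i s j
    D₁ = Within s (size t)
    D₂ = Within c (size u)

    c≤j : c ≤ j
    c≤j = proj₂ (fits-parˡ t u F)

    -- The inner vertices of the branches form disjoint blocks strictly between `i` and `j`. So an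
    -- edge with an end in the block of `t` belongs to `t`, and its other end can leave the block
    -- only to `i` or `j`.
    back₁ : ∀ {y p q} → i ≤ p → D₁ q → ρ y p q → edges t i s j y p q × (i < p → D₁ p)
    back₁ _ _ (inj₁ x) =
      x , λ i<p → [ (λ { refl → ⊥-elim (<-irrefl refl i<p) }) , id ]′ (proj₁ (edges-vertices t x))
    back₁ _ (_ , q<c) (inj₂ x) with proj₂ (edges-vertices u x)
    ... | inj₁ refl      = ⊥-elim (<-irrefl refl (<-≤-trans q<c c≤j))
    ... | inj₂ (c≤q , _) = ⊥-elim (<-irrefl refl (<-≤-trans q<c c≤q))

    forth₁ : ∀ {y p q} → q ≤ j → D₁ p → ρ y p q → edges t i s j y p q × (q < j → D₁ q)
    forth₁ _ _ (inj₁ x) =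
      x , λ q<j → [ (λ { refl → ⊥-elim (<-irrefl refl q<j) }) , id ]′ (proj₂ (edges-vertices t x))
    forth₁ _ (s≤p , p<c) (inj₂ x) with proj₁ (edges-vertices u x)
    ... | inj₁ refl      = ⊥-elim (<-irrefl refl (<-≤-trans (proj₁ F) s≤p))
    ... | inj₂ (c≤p , _) = ⊥-elim (<-irrefl refl (<-≤-trans p<c c≤p))

    back₂ : ∀ {y p q} → i ≤ p → D₂ q → ρ y p q → edges u i c j y p q × (i < p → D₂ p)
    back₂ _ (c≤q , q<d) (inj₁ x) with proj₂ (edges-vertices t x)
    ... | inj₁ refl      = ⊥-elim (<-irrefl refl (<-≤-trans q<d (proj₂ (fits-parʳ t u F))))
    ... | inj₂ (_ , q<c) = ⊥-elim (<-irrefl refl (<-≤-trans q<c c≤q))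
    back₂ _ _ (inj₂ x) =
      x , λ i<p → [ (λ { refl → ⊥-elim (<-irrefl refl i<p) }) , id ]′ (proj₁ (edges-vertices u x))

    forth₂ : ∀ {y p q} → q ≤ j → D₂ p → ρ y p q → edges u i c j y p q × (q < j → D₂ q)
    forth₂ _ (c≤p , _) (inj₁ x) with proj₁ (edges-vertices t x)
    ... | inj₁ refl      = ⊥-elim (<-irrefl refl (<-≤-trans (proj₁ (fits-parʳ t u F)) c≤p))
    ... | inj₂ (_ , p<c) = ⊥-elim (<-irrefl refl (<-≤-trans p<c c≤p))
    forth₂ _ _ (inj₂ x) =
      x , λ q<j → [ (λ { refl → ⊥-elim (<-irrefl refl q<j) }) , id ]′ (proj₂ (edges-vertices u x))

    inner : ∀ {y p q} → ρ y p q → q < j → D₁ q ⊎ D₂ q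
    inner (inj₁ x) q<j with proj₂ (edges-vertices t x)
    ... | inj₁ refl = ⊥-elim (<-irrefl refl q<j)
    ... | inj₂ d    = inj₁ d
    inner (inj₂ x) q<j with proj₂ (edges-vertices u x)
    ... | inj₁ refl = ⊥-elim (<-irrefl refl q<j)
    ... | inj₂ d    = inj₂ d

  -- The inner vertex on the path decides the branch, and a path cannot change branches there.
  par-path : ∀ f g → Rel ρ (f ∙ g) i j → Rel (edges t i s j) (f ∙ g) i j ⊎ Rel (edges u i c j) (f ∙ g) i j
  par-path f g (m , x , y) with Rel-target f x
  ... | _ , _ , z with inner z (Rel-< (edges-< (par t u) F) g y)
  ...   | inj₁ d = inj₁ (m , proj₁ (Rel-restrictˡ inc D₁ back₁ f ≤-refl d x)
                           , proj₁ (Rel-restrictʳ inc D₁ forth₁ g ≤-refl d y))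
    where inc = edges-< (par t u) F
  ...   | inj₂ d = inj₂ (m , proj₁ (Rel-restrictˡ inc D₂ back₂ f ≤-refl d x)
                           , proj₁ (Rel-restrictʳ inc D₂ forth₂ g ≤-refl d y))
    where inc = edges-< (par t u) F

-- An upper bound U of all terms under consideration plays the role of the missing top element.
module _ {X : Set} (U : Expr X) where

  -- `nothing` puts no constraint on a branch. Meeting `just s` with `U` makes `U` the greatest of
  -- these expressions.
  ⟪_⟫? : {f : Core X} → Maybe (Segment f) → Expr X
  ⟪ just s ⟫?  = ⟪ s ⟫ ⊓ U
  ⟪ nothing ⟫? = U

  Rel? : Model X → {f : Core X} → Maybe (Segment f) → ℕ → ℕ → Set
  Rel? ρ (just s) p q = Rel ρ (core s) p q
  Rel? ρ nothing  p q = ⊤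

  merge : {f g : Core X} → Maybe (Segment f) → Maybe (Segment g) → Maybe (Segment (f ∩ g))
  merge (just u) (just v) = just (both u v)
  merge (just u) nothing  = just (inl u)
  merge nothing  (just v) = just (inr v)
  merge nothing  nothing  = nothing

  merge-≲ : {f g : Core X} (u : Maybe (Segment f)) (v : Maybe (Segment g)) →
            ⟪ merge u v ⟫? ≲ ⟪ u ⟫? ⊓ ⟪ v ⟫?
  merge-≲ (just u) (just v) =
    ⊓-glb (⊓-mono ⊓-lowerˡ ≲-refl) (⊓-mono ⊓-lowerʳ ≲-refl)
  merge-≲ (just u) nothing  = ⊓-glb ≲-refl ⊓-lowerʳ
  merge-≲ nothing  (just v) = ⊓-glb ⊓-lowerʳ ≲-refl
  merge-≲ nothing  nothing  = ⊓-glb ≲-refl ≲-refl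

  merge-Rel : ∀ {ρ p q} {f g : Core X} (u : Maybe (Segment f)) (v : Maybe (Segment g)) →
              Rel? ρ u p q → Rel? ρ v p q → Rel? ρ (merge u v) p q
  merge-Rel (just u) (just v) x y = x , y
  merge-Rel (just u) nothing  x y = x
  merge-Rel nothing  (just v) x y = y
  merge-Rel nothing  nothing  x y = tt

  module _ {f g : Core X} (h : Segment f → Segment g) (core-h : ∀ s → core (h s) ≡ core s) where

    map-⟪⟫? : (s : Maybe (Segment f)) → ⟪ Maybe.map h s ⟫? ≡ ⟪ s ⟫?
    map-⟪⟫? (just s) = cong (λ c → ⌜ c ⌝ ⊓ U) (core-h s)
    map-⟪⟫? nothing  = refl

    map-Rel? : ∀ {ρ p q} (s : Maybe (Segment f)) → Rel? ρ s p q → Rel? ρ (Maybe.map h s) p q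
    map-Rel? {ρ} {p} {q} (just s) x = subst (λ c → Rel ρ c p q) (sym (core-h s)) x
    map-Rel? nothing x = x

  module _ (ρ ρ₁ ρ₂ : Model X) (i j : ℕ)
    (edge : ∀ {y} → ρ y i j → ρ₁ y i j ⊎ ρ₂ y i j)
    (path : ∀ f g → Rel ρ (f ∙ g) i j → Rel ρ₁ (f ∙ g) i j ⊎ Rel ρ₂ (f ∙ g) i j) where

    ParSplit : {f : Core X} → Expr X → Set
    ParSplit {f} e = ∃₂ λ (l r : Maybe (Segment f)) →
      ⟪ l ⟫? ⊓ ⟪ r ⟫? ≲ e × Rel? ρ₁ l i j × Rel? ρ₂ r i j

    onOneSide : ∀ {f} (s : Segment f) → Rel ρ₁ (core s) i j ⊎ Rel ρ₂ (core s) i j →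
                ParSplit {f} ⟪ s ⟫
    onOneSide s (inj₁ x) = just s , nothing , ≲-trans ⊓-lowerˡ ⊓-lowerˡ , x , tt
    onOneSide s (inj₂ x) = nothing , just s , ≲-trans ⊓-lowerʳ ⊓-lowerˡ , tt , x

    mapSplit : ∀ {f g e e′} (h : Segment f → Segment g) → (∀ s → core (h s) ≡ core s) → e ≲ e′ →
               ParSplit {f} e → ParSplit {g} e′
    mapSplit {e′ = e′} h core-h e≲e′ (l , r , le , a , b) =
      Maybe.map h l , Maybe.map h r ,
      subst₂ (λ x y → x ⊓ y ≲ e′) (sym (map-⟪⟫? h core-h l)) (sym (map-⟪⟫? h core-h r))
        (≲-trans le e≲e′) ,
      map-Rel? h core-h l a , map-Rel? h core-h r b

    -- A composite path lies in one branch by `path`, so its segment goes to that side undivided.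
    -- Only unions, meets and iterations with a single factor are taken apart.
    Rel-parSplit : ∀ f (s : Segment f) → Rel ρ (core s) i j → ParSplit {f} ⟪ s ⟫
    Rel-parSplit (lit y) atom x = onOneSide atom (edge x)
    Rel-parSplit (bin o f g) (inl u) x = mapSplit inl (λ _ → refl) ≲-refl (Rel-parSplit f u x)
    Rel-parSplit (bin o f g) (inr v) x = mapSplit inr (λ _ → refl) ≲-refl (Rel-parSplit g v x)
    Rel-parSplit (f ∪ g) (both u v) (inj₁ x) =
      mapSplit inl (λ _ → refl) ⊕-upperˡ (Rel-parSplit f u x)
    Rel-parSplit (f ∪ g) (both u v) (inj₂ x) =
      mapSplit inr (λ _ → refl) ⊕-upperʳ (Rel-parSplit g v x)
    Rel-parSplit (f ∙ g) (both u v) x = onOneSide (both u v) (path (core u) (core v) x)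
    Rel-parSplit (f ∩ g) (both u v) (x , y) with Rel-parSplit f u x | Rel-parSplit g v y
    ... | l , r , le , a , b | l′ , r′ , le′ , a′ , b′ =
      merge l l′ , merge r r′ ,
      ≲-trans (⊓-mono (merge-≲ l l′) (merge-≲ r r′))
        (⊓-glb (≲-trans (⊓-mono ⊓-lowerˡ ⊓-lowerˡ) le) (≲-trans (⊓-mono ⊓-lowerʳ ⊓-lowerʳ) le′)) ,
      merge-Rel l l′ a a′ , merge-Rel r r′ b b′
    Rel-parSplit (f ₊) (one u) x = mapSplit one (λ _ → refl) ≲-refl (Rel-parSplit f u x)
    Rel-parSplit (f ₊) (suf u) (inj₁ x) =
      mapSplit one (λ _ → refl) ⊕-upperˡ (Rel-parSplit f u x)
    Rel-parSplit (f ₊) (suf u) (inj₂ x) =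
      onOneSide (suf u) (Sum.map inj₂ inj₂ (path (core u) (f ₊) x))
    Rel-parSplit (f ₊) (pre v) (inj₁ x) =
      mapSplit one (λ _ → refl) ⊕-upperˡ (Rel-parSplit f v x)
    Rel-parSplit (f ₊) (pre v) (inj₂ x) =
      onOneSide (pre v) (Sum.map inj₂ inj₂ (path (f ₊) (core v) x))
    Rel-parSplit (f ₊) (seg u v) x = onOneSide (seg u v) (path (starʳ f (core u)) (core v) x)
    -- A single factor is a path of `f` itself, and `f` may be a meet whose members use different
    -- branches; the splitting continues in `whole f`.
    Rel-parSplit (f ₊) iter (m , x , ε) =
      mapSplit one (λ _ → refl) (≲-trans (≲-reflexive′ (cong ⌜_⌝ (core-whole f))) ⁺-base)
        (Rel-parSplit f (whole f) (subst (λ g → Rel ρ g i j) (sym (core-whole f)) x))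
      where
      ≲-reflexive′ : ∀ {a b} → a ≡ b → a ≲ b
      ≲-reflexive′ refl = ≲-refl
    Rel-parSplit (f ₊) iter (m , x , y ◅ ys) =
      onOneSide iter (Sum.map cons cons (path f (f ₊) (m , x , _ , y , ys)))
      where
      cons : ∀ {ρ p q} → Rel ρ (f ∙ f ₊) p q → Rel ρ (f ₊) p q
      cons (m , x , _ , y , ys) = m , x , y ◅ ys

  -- Derivability of t ≲ s by repeated splitting.
  infix 4 _⊩_ _⊩?_
  _⊩_ : Term X → {f : Core X} → Segment f → Set
  _⊩?_ : Term X → {f : Core X} → Maybe (Segment f) → Set
  leaf y ⊩ s = literal y ≲ ⟪ s ⟫
  _⊩_ (ser t u) {f} s = ∃₂ λ (l r : Segment f) → ⟪ l ⟫ ⊙ ⟪ r ⟫ ≲ ⟪ s ⟫ × t ⊩ l × u ⊩ r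
  _⊩_ (par t u) {f} s = ∃₂ λ (l r : Maybe (Segment f)) → ⟪ l ⟫? ⊓ ⟪ r ⟫? ≲ ⟪ s ⟫ × t ⊩? l × u ⊩? r
  t ⊩? just s  = t ⊩ s
  t ⊩? nothing = ⊤

  -- Induction on `t`: a path through `ser` is cut at the joining vertex and one through `par` is
  -- split by branches. The pieces live in the drawings of the components, where the induction
  -- hypotheses apply.
  Rel⇒⊩ : ∀ (t : Term X) {i s j} → Fits t i s j → {f : Core X} (a : Segment f) →
          Rel (edges t i s j) (core a) i j → t ⊩ a
  Rel?⇒⊩? : ∀ (t : Term X) {i s j} → Fits t i s j → {f : Core X} (a : Maybe (Segment f)) →
            Rel? (edges t i s j) a i j → t ⊩? a
  Rel⇒⊩ (leaf x) {s = s} F a r = proj₂ (proj₂ (Rel-leaf s (fits-< (leaf x) F) (core a) r))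
  Rel⇒⊩ (ser t u) {i} {s} {j} F {f} a r
    with Rel-cut (edges (ser t u) i s j) (edges-< (ser t u) F) (s + size t) uncrossed f a
           (fits-< t Ft) (fits-< u Fu) r
    where
    Ft = fits-serˡ t u F
    Fu = fits-serʳ t u F
    -- Edges of `t` end at or before the joining vertex and edges of `u` start at or after it.
    uncrossed : ∀ {y p q} → edges (ser t u) i s j y p q → p < s + size t → s + size t < q → ⊥
    uncrossed (inj₁ x) _ k<q = <-irrefl refl (<-≤-trans k<q (edges-≤ t Ft x))
    uncrossed (inj₂ x) p<k _ = <-irrefl refl (<-≤-trans p<k (edges-≥ u Fu x))
  ... | l , r , le , x , y =
    l , r , le ,
    Rel⇒⊩ t Ft l (proj₁ (Rel-restrictˡ inc (_≤ k) back (core l) ≤-refl ≤-refl x)) ,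
    Rel⇒⊩ u Fu r (proj₁ (Rel-restrictʳ inc (k ≤_) forth (core r) ≤-refl ≤-refl y))
    where
    k = s + size t
    Ft = fits-serˡ t u F
    Fu = fits-serʳ t u F
    inc = edges-< (ser t u) F
    back : ∀ {y p q} → i ≤ p → q ≤ k → edges (ser t u) i s j y p q →
           edges t i s k y p q × (i < p → p ≤ k)
    back _ q≤k (inj₁ x) = x , λ _ → ≤-trans (<⇒≤ (edges-< t Ft _ x)) q≤k
    back _ q≤k (inj₂ x) =
      ⊥-elim (<-irrefl refl (<-≤-trans (≤-<-trans (edges-≥ u Fu x) (edges-< u Fu _ x)) q≤k))
    forth : ∀ {y p q} → q ≤ j → k ≤ p → edges (ser t u) i s j y p q →
            edges u k (suc k) j y p q × (q < j → k ≤ q)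
    forth _ k≤p (inj₁ x) =
      ⊥-elim (<-irrefl refl (≤-<-trans k≤p (<-≤-trans (edges-< t Ft _ x) (edges-≤ t Ft x))))
    forth _ k≤p (inj₂ x) = x , λ _ → ≤-trans k≤p (<⇒≤ (edges-< u Fu _ x))
  Rel⇒⊩ (par t u) {i} {s} {j} F {f} a r
    with Rel-parSplit (edges (par t u) i s j) (edges t i s j) (edges u i (s + size t) j) i j
           id (par-path t u F) f a r
  ... | l , r , le , x , y =
    l , r , le , Rel?⇒⊩? t (fits-parˡ t u F) l x , Rel?⇒⊩? u (fits-parʳ t u F) r y
  Rel?⇒⊩? t F (just a) r = Rel⇒⊩ t F a r
  Rel?⇒⊩? t F nothing  r = tt

-- Covering an expression by finitely many meets of segments

sublists : List A → List (List A)
sublists []       = [] ∷ []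
sublists (x ∷ xs) = map (x ∷_) (sublists xs) ++ sublists xs

-- Replacing falsity by the goal P makes excluded middle available when proving P;
-- in particular no decidable equality on X is needed.
module Continuation (P : Set) where

  T : Set → Set
  T A = (A → P) → P

  return : {A : Set} → A → T A
  return a k = k a

  infixl 1 _>>=_
  _>>=_ : {A B : Set} → T A → (A → T B) → T B
  (m >>= f) k = m λ a → f a k

  excludedMiddle : (Q : Set) → T (Q ⊎ (Q → P))
  excludedMiddle Q k = k (inj₂ (k ∘ inj₁))

  -- Filters by a property that need not be decidable. A rejected entry comes only with `Q x → P`,
  -- so membership of all entries satisfying `Q` holds under `T`.
  select : {A : Set} (Q : A → Set) (xs : List A) →
           T (∃ λ ys → ys ∈ sublists xs × All Q ys × (∀ {x} → x ∈ xs → Q x → T (x ∈ ys)))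
  select Q []       = return ([] , here refl , [] , λ ())
  select Q (x ∷ xs) = select Q xs >>= λ (ys , sub , all , full) →
    excludedMiddle (Q x) >>= λ where
      (inj₁ q) → return
        (x ∷ ys , ∈-++⁺ˡ (∈-map⁺ (x ∷_) sub) , q ∷ all ,
         λ { (here refl) _  → return (here refl)
           ; (there i)   q′ → full i q′ >>= (return ∘ there) })
      (inj₂ ¬q) → return
        (ys , ∈-++⁺ʳ (map (x ∷_) (sublists xs)) sub , all ,
         λ { (here refl) q _ → ¬q q ; (there i) q → full i q })

-- Its iteration will be the bound `U`: it lies above all literals of the expression and is closed
-- under composition.
literals : Core X → Expr X
literals (lit y)     = literal y
literals ∅           = 𝟘
literals (bin _ f g) = literals f ⊕ literals g
literals (f ₊)       = literals f

module Cover {X : Set} (P : Set) (U : Expr X) (UU≲U : U ⊙ U ≲ U) (f : Core X) where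

  open Continuation P

  private
    variable
      x z : Expr X
      G H K : Term X → Set

    infix 4 _⊢_
    _⊢_ : Term X → Segment f → Set
    t ⊢ s = _⊩_ U t s

  meet : List (Segment f) → Expr X
  meet []       = U
  meet (s ∷ m) = ⟪ s ⟫ ⊓ meet m

  meet≲U : ∀ m → meet m ≲ U
  meet≲U []      = ≲-refl
  meet≲U (s ∷ m) = ≲-trans ⊓-lowerʳ (meet≲U m)

  meet-lower : ∀ {s m} → s ∈ m → meet m ≲ ⟪ s ⟫
  meet-lower (here refl) = ⊓-lowerˡ
  meet-lower (there i)   = ≲-trans ⊓-lowerʳ (meet-lower i)

  meet-glb : ∀ {m} → x ≲ U → All (λ s → x ≲ ⟪ s ⟫) m → x ≲ meet m
  meet-glb x≲U []       = x≲U
  meet-glb x≲U (p ∷ ps) = ⊓-glb p (meet-glb x≲U ps)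

  Complete : List (Segment f) → Term X → Set
  Complete m t = ∀ s → t ⊢ s → T (s ∈ m)

  -- The witness `t` ties a meet to an actual term, so that what holds of all terms with `G` puts
  -- segments into `m`. Being a sublist leaves only finitely many candidates for `m`.
  Good : (Term X → Set) → List (Segment f) → Set
  Good G m = m ∈ sublists (segments f) × ∃ λ t → G t × Complete m t

  join : List (List (Segment f)) → Expr X
  join []       = 𝟘
  join (m ∷ ms) = meet m ⊕ join ms

  join-upper : ∀ {m ms} → m ∈ ms → meet m ≲ join ms
  join-upper (here refl) = ⊕-upperˡ
  join-upper (there i)   = ≲-trans (join-upper i) ⊕-upperʳ

  join-++ : ∀ ms ns → join ms ⊕ join ns ≲ join (ms ++ ns)
  join-++ []       ns = ⊕-lub 𝟘-least ≲-refl
  join-++ (m ∷ ms) ns =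
    ≲-trans (≲-reflexive (≣-sym (⊕-assoc (meet m) (join ms) (join ns))))
      (⊕-mono ≲-refl (join-++ ms ns))

  join-least : ∀ {ms} → (∀ {m} → Good G m → T (meet m ≲ z)) → All (Good G) ms → T (join ms ≲ z)
  join-least h []       = return 𝟘-least
  join-least h (g ∷ gs) = h g >>= λ p → join-least h gs >>= λ q → return (⊕-lub p q)

  Covered : (Term X → Set) → Expr X → Set
  Covered G x = T (∃ λ ms → All (Good G) ms × x ≲ join ms)

  covered-mono : (∀ {t} → G t → H t) → Covered G x → Covered H x
  covered-mono h c = c >>= λ (ms , gs , p) →
    return (ms , All.map (λ (i , t , g , full) → i , t , h g , full) gs , p)

  covered-⊕ : Covered G x → Covered G z → Covered G (x ⊕ z)
  covered-⊕ c d =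
    c >>= λ (ms , gs , p) → d >>= λ (ns , hs , q) →
    return (ms ++ ns , ++⁺ gs hs , ≲-trans (⊕-mono p q) (join-++ ms ns))

  -- An operation compatible with finite joins is applied to each covering meet separately, and the
  -- resulting covers are concatenated.
  covered-bind : (op : Expr X → Expr X) → (∀ {a b} → a ≲ b → op a ≲ op b) → op 𝟘 ≲ 𝟘 →
                 (∀ a b → op (a ⊕ b) ≲ op a ⊕ op b) →
                 (∀ {m} → Good G m → Covered H (op (meet m))) → Covered G x → Covered H (op x)
  covered-bind {G} {H} op mono strict add h c = c >>= λ (ms , gs , p) →
    go gs >>= λ (ns , hs , q) → return (ns , hs , ≲-trans (mono p) q)
    where
    go : ∀ {ms} → All (Good G) ms → Covered H (op (join ms))
    go []                 = return ([] , [] , strict)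
    go {m ∷ ms} (g ∷ gs) = covered-⊕ (h g) (go gs) >>= λ (ns , hs , q) →
      return (ns , hs , ≲-trans (add (meet m) (join ms)) q)

  -- The segments above x form a list that is complete for t as soon as
  -- x lies below every segment derivable for t.
  covered-unit : ∀ {t} → G t → x ≲ U → (∀ s → t ⊢ s → T (x ≲ ⟪ s ⟫)) → Covered G x
  covered-unit {x = x} {t} g x≲U below =
    select (λ s → x ≲ ⟪ s ⟫) (segments f) >>= λ (m , sub , all , full) →
    return
      (m ∷ [] ,
       (sub , t , g , λ s d → below s d >>= full (segments-complete f s)) ∷ [] ,
       ≲-trans (meet-glb x≲U all) ⊕-upperˡ)

  -- A derivation of `s` for `ser t u` splits into `l` for `t` and `r` for `u`. Completeness places
  -- `l` in `m` and `r` in `n`, so the product of the two meets lies below `s`, as `covered-unit`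
  -- demands.
  covered-⊙ : (∀ {t u} → G t → H u → K (ser t u)) → Covered G x → Covered H z → Covered K (x ⊙ z)
  covered-⊙ {z = z} h c d =
    covered-bind (_⊙ z) ⊙-monoˡ (≲-reflexive (⊙-zeroˡ z))
      (λ a b → ≲-reflexive (⊙-distrʳ a b z))
      (λ {m} (_ , t , g , full) →
        covered-bind (meet m ⊙_) ⊙-monoʳ (≲-reflexive (⊙-zeroʳ (meet m)))
          (λ a b → ≲-reflexive (⊙-distrˡ (meet m) a b))
          (λ {n} (_ , u , g′ , full′) →
            covered-unit (h g g′) (≲-trans (⊙-mono (meet≲U m) (meet≲U n)) UU≲U)
              λ s (l , r , le , dl , dr) →
                full l dl >>= λ i → full′ r dr >>= λ j →
                return (≲-trans (⊙-mono (meet-lower i) (meet-lower j)) le))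
          d)
      c

  meet-lower? : ∀ {t m} → Complete m t → (s : Maybe (Segment f)) → _⊩?_ U t s →
                T (meet m ≲ ⟪_⟫? U s)
  meet-lower? {m = m} full (just s) d =
    full s d >>= λ i → return (⊓-glb (meet-lower i) (meet≲U m))
  meet-lower? {m = m} full nothing  d = return (meet≲U m)

  covered-⊓ : (∀ {t u} → G t → H u → K (par t u)) → Covered G x → Covered H z → Covered K (x ⊓ z)
  covered-⊓ {z = z} h c d =
    covered-bind (_⊓ z) (λ p → ⊓-mono p ≲-refl) ⊓-lowerˡ
      (λ a b → ≲-reflexive (⊓-distr a b z))
      (λ {m} (_ , t , g , full) →
        covered-bind (meet m ⊓_) (⊓-mono ≲-refl) ⊓-lowerʳ
          (λ a b → ≲-reflexive
            (≣-trans (⊓-comm (meet m) (a ⊕ b))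
              (≣-trans (⊓-distr a b (meet m)) (⊕-cong (⊓-comm a (meet m)) (⊓-comm b (meet m))))))
          (λ {n} (_ , u , g′ , full′) →
            covered-unit (h g g′) (≲-trans ⊓-lowerˡ (meet≲U m))
              λ s (l , r , le , dl , dr) →
                meet-lower? full l dl >>= λ p → meet-lower? full′ r dr >>= λ q →
                return (≲-trans (⊓-mono p q) le))
          d)
      c

  -- There are finitely many lists of segments, so the join of all good ones exists;
  -- it contains e and is closed under left multiplication by e.
  covered-⁺ : ∀ {e} → (∀ {t} → G t → H t) → (∀ {t u} → G t → H u → H (ser t u)) →
              Covered G e → Covered H (e ⁺)
  covered-⁺ {G} {H} {e} incl comp c =
    select (Good H) (sublists (segments f)) >>= λ (ms , _ , good , full) →
    let below : ∀ {x} → Covered H x → T (x ≲ join ms)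
        below d = d >>= λ (ns , hs , p) →
          join-least (λ g → full (proj₁ g) g >>= (return ∘ join-upper)) hs >>= λ q →
          return (≲-trans p q)
    in
    below (covered-mono incl c) >>= λ base →
    below (covered-⊙ comp c (return (ms , good , ≲-refl))) >>= λ closed →
    return (ms , good , ⁺-least base closed)

  covered : ∀ e → literals e ≲ U → Covered (_∈ᵀ e) ⌜ e ⌝
  -- Derivability of `s` for a leaf is by definition the inequality wanted.
  covered (lit y) le = covered-unit leaf le (λ s d → return d)
  covered ∅       le = return ([] , [] , ≲-refl)
  covered (e ∪ g) le =
    covered-⊕ (covered-mono inl (covered e (≲-trans ⊕-upperˡ le)))
              (covered-mono inr (covered g (≲-trans ⊕-upperʳ le)))
  covered (e ∙ g) le =
    covered-⊙ ser (covered e (≲-trans ⊕-upperˡ le)) (covered g (≲-trans ⊕-upperʳ le))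
  covered (e ∩ g) le =
    covered-⊓ par (covered e (≲-trans ⊕-upperˡ le)) (covered g (≲-trans ⊕-upperʳ le))
  covered (e ₊)   le = covered-⁺ one more (covered e le)

-- Completeness

core-complete : (e f : Core X) → (∀ {t} → t ∈ᵀ e → _⊩_ (literals e ⁺) t (whole f)) →
                ⌜ e ⌝ ≲ ⌜ f ⌝
-- The goal itself was chosen as `P`, so the continuation-passing argument ends in it; the final
-- continuation is `≲-trans p`.
core-complete e f H = covered e ⁺-base λ (ms , gs , p) →
  join-least
    -- The witness `t` is a term of `e`, so `H` and completeness make `whole f` a factor of the
    -- meet.
    (λ {m} (_ , t , t∈e , full) → full (whole f) (H t∈e) >>= λ i →
      return (subst (λ g → meet m ≲ ⌜ g ⌝) (core-whole f) (meet-lower i)))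
    gs (≲-trans p)
  where
  open Continuation (⌜ e ⌝ ≲ ⌜ f ⌝)
  open Cover (⌜ e ⌝ ≲ ⌜ f ⌝) (literals e ⁺) ⁺-trans f

-- For each term of `e` the inclusion is tested in one model only, the drawing of that term, on the
-- word that spells the drawing from end to end.
⟦⟧-complete : (e f : Expr X) →
              (∀ (A : Set) (σ : X → Lang A) w → ⟦ e ⟧ σ w → ⟦ f ⟧ σ w) → e ≲ f
⟦⟧-complete e f H =
  ≲-trans (≲-reflexive (≣-sym (pushMirror-≣ false e)))
    (≲-trans (core-complete ê f̂ derivable) (≲-reflexive (pushMirror-≣ false f)))
  where
  ê = pushMirror false e
  f̂ = pushMirror false f
  derivable : ∀ {t} → t ∈ᵀ ê → _⊩_ (literals ê ⁺) t (whole f̂)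
  derivable {t} t∈e =
    Rel⇒⊩ (literals ê ⁺) t F (whole f̂)
      (subst (λ g → Rel ρ g 0 j) (sym (core-whole f̂))
        (⟦⟧⇒Rel ρ inc false f (fits-< t F)
          (H (ℕ × Bool) (wordModel ρ inc) (W 0 j) (Rel⇒⟦⟧ ρ inc false e (edges⇒Rel {s = 1} t∈e id)))))
    where
    -- The source is 0 and the inner vertices are 1 up to `size t`, so this is the next free vertex.
    j = 1 + size t
    ρ = edges t 0 1 j
    F : Fits t 0 1 j
    F = s≤s z≤n , ≤-refl
    inc = edges-< t F

theorem9 : {X : Set} (e f : Expr X) → (e ≣ f) ⇔ (e ≃ f)
theorem9 e f = mk⇔
  (λ p A σ w → mk⇔ (proj₁ (⟦⟧-sound p w)) (proj₂ (⟦⟧-sound p w)))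
  (λ H → ≲-antisym
    (⟦⟧-complete e f (λ A σ w → Equivalence.to (H A σ w)))
    (⟦⟧-complete f e (λ A σ w → Equivalence.from (H A σ w))))
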